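{- Permutation Pattern Matching (PPM), i.e. the problem of computing, given a length-$n$ permutation $\sigma$ and a length-$k$ permutation $\pi$, the number of solutions to $(\sigma,\pi)$, can be solved in time $O\left(n\cdot 2^{\lfloor n/2\rfloor}\right)=O(1.415^{n})$ using $O(n)$ space.
   Context: For a positive integer $m$, $[m]=\{1,\ldots,m\}$. A permutation of length $m$ is a bijection $[m]\to[m]$. Permutation Pattern Matching (PPM): the input is a length-$n$ permutation $\sigma$ and a length-$k$ permutation $\pi$; the output is the number of solutions to $(\sigma,\pi)$. A solution to $(\sigma,\pi)$ is an injection $f:[k]\to[n]$ such that for all $i,j\in[k]$: (1) $\pi(i)<\pi(j)\Leftrightarrow\sigma(f(i))<\sigma(f(j))$, and (2) $i<j\Leftrightarrow f(i)<f(j)$. Model of computation: when analysing the complexity of the algorithm, constant-time arithmetic operations on integers not exceeding the number of solutions are assumed, and the standard Word RAM model is used otherwise. (Without this assumption on arithmetic, the overall time complexity should be multiplied by another factor of $n$.) -}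

module Defs where

open import Data.Bool using (Bool; true; false; if_then_else_; _∧_; _∨_; _xor_)
open import Data.Fin using (Fin; toℕ) renaming (_<_ to _<ᶠ_)
import Data.Fin.Properties as Fin
open import Data.Fin.Permutation using (Permutation′; _⟨$⟩ʳ_)
open import Data.List using (List; []; _∷_; _++_; [_]; allFin; cartesianProductWith; drop; filter; head; length; map)
open import Data.Maybe using (Maybe; just; nothing; fromMaybe)
open import Data.Nat
open import Data.Nat.DivMod using (_/_; _%_)
open import Data.Nat.Properties using (m^n≢0)
open import Data.Product using (_×_; _,_; ∃-syntax)
open import Data.Vec using (Vec; lookup; []; _∷_)
open import Function.Bundles using (_⇔_; mk⇔; Equivalence)
open import Function.Definitions using (Injective)
open import Relation.Binary.PropositionalEquality using (_≡_)
open import Relation.Nullary using (Dec)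
open import Relation.Nullary.Decidable using (map′; _×-dec_; _→-dec_)

IsSolution : ∀ {n k} → Permutation′ n → Permutation′ k → (Fin k → Fin n) → Set
IsSolution σ π f =
  Injective _≡_ _≡_ f
  × (∀ i j → ((π ⟨$⟩ʳ i) <ᶠ (π ⟨$⟩ʳ j)) ⇔ ((σ ⟨$⟩ʳ f i) <ᶠ (σ ⟨$⟩ʳ f j)))
  × (∀ i j → (i <ᶠ j) ⇔ (f i <ᶠ f j))

_⇔-dec_ : {A B : Set} → Dec A → Dec B → Dec (A ⇔ B)
a? ⇔-dec b? =
  map′ (λ (f , g) → mk⇔ f g) (λ e → Equivalence.to e , Equivalence.from e)
       ((a? →-dec b?) ×-dec (b? →-dec a?))

isSolution? : ∀ {n k} (σ : Permutation′ n) (π : Permutation′ k) (f : Fin k → Fin n) →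
              Dec (IsSolution σ π f)
isSolution? σ π f =
  map′ (λ inj {x} {y} → inj x y) (λ inj x y → inj {x} {y})
       (Fin.all? λ x → Fin.all? λ y → (f x Fin.≟ f y) →-dec (x Fin.≟ y))
  ×-dec
  (Fin.all? λ i → Fin.all? λ j →
    ((π ⟨$⟩ʳ i) Fin.<? (π ⟨$⟩ʳ j)) ⇔-dec ((σ ⟨$⟩ʳ f i) Fin.<? (σ ⟨$⟩ʳ f j)))
  ×-dec
  (Fin.all? λ i → Fin.all? λ j → (i Fin.<? j) ⇔-dec (f i Fin.<? f j))

-- Each function Fin k → Fin n occurs exactly once, as its vector of values.
allMaps : ∀ n k → List (Vec (Fin n) k)
allMaps n zero    = [ [] ]
allMaps n (suc k) = cartesianProductWith _∷_ (allFin n) (allMaps n k)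

#solutions : ∀ {n k} → Permutation′ n → Permutation′ k → ℕ
#solutions {n} {k} σ π =
  length (filter (λ v → isSolution? σ π (lookup v)) (allMaps n k))

Reg : Set
Reg = ℕ

data ArithOp : Set where
  add sub mul div mod : ArithOp

data BitOp : Set where
  and or xor shl shr : BitOp

data Instr : Set where
  const : Reg → ℕ → Instr                   -- const r c: r ← c
  arith : ArithOp → Reg → Reg → Reg → Instr -- arith o r a b: r ← a o b
  bit   : BitOp → Reg → Reg → Reg → Instr   -- bit o r a b: r ← a o b
  load  : Reg → Reg → Instr                 -- load r a: r ← M[a]
  store : Reg → Reg → Instr                 -- store a r: M[a] ← r
  jump  : ℕ → Instr
  jlt   : Reg → Reg → ℕ → Instr             -- jlt a b l: if a < b, jump to l
  jeq   : Reg → Reg → ℕ → Instr             -- jeq a b l: if a = b, jump to l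
  halt  : Instr

-- Jump targets are absolute indices into the list.
Program : Set
Program = List Instr

-- space is one more than the largest memory address read or written so far.
-- Registers are not counted: a fixed program mentions only a fixed number of them.
record State : Set where
  constructor ⟨_,_,_,_⟩
  field
    pc    : ℕ
    reg   : Reg → ℕ
    mem   : ℕ → ℕ
    space : ℕ

open State public

_[_≔_] : (ℕ → ℕ) → ℕ → ℕ → (ℕ → ℕ)
(g [ a ≔ v ]) x = if x ≡ᵇ a then v else g x

_!?_ : {A : Set} → List A → ℕ → Maybe A
xs !? i = head (drop i xs)

_mod2^_ : ℕ → ℕ → ℕ
a mod2^ w = (a % 2 ^ w) {{m^n≢0 2 w}}

-- Words have w bits.  Unit-cost arithmetic is in addition available on integers
-- below 2 ^ W, where W ≥ w: registers and cells hold integers below 2 ^ W, and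
-- arithmetic, comparisons and moves act on these.  Addresses, constants and
-- bitwise operations are restricted to words.
module WordRAM (w W : ℕ) where

  -- Wraps around modulo 2 ^ W; division and remainder by 0 give 0.
  evalArith : ArithOp → ℕ → ℕ → ℕ
  evalArith add a b       = (a + b) mod2^ W
  evalArith sub a b       = (a + (2 ^ W ∸ b)) mod2^ W
  evalArith mul a b       = (a * b) mod2^ W
  evalArith div a zero    = 0
  evalArith div a (suc b) = a / suc b
  evalArith mod a zero    = 0
  evalArith mod a (suc b) = a % suc b

  odd? : ℕ → Bool
  odd? a = a % 2 ≡ᵇ 1

  bitwise : (Bool → Bool → Bool) → ℕ → ℕ → ℕ → ℕ
  bitwise f zero    a b = 0
  bitwise f (suc l) a b =
    (if f (odd? a) (odd? b) then 1 else 0) + 2 * bitwise f l (a / 2) (b / 2)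

  evalBit : BitOp → ℕ → ℕ → ℕ
  evalBit and a b = bitwise _∧_ w a b
  evalBit or  a b = bitwise _∨_ w a b
  evalBit xor a b = bitwise _xor_ w a b
  evalBit shl a b = (a * 2 ^ b) mod2^ w
  evalBit shr a b = ((a mod2^ w) / 2 ^ b) {{m^n≢0 2 b}}

  exec : Instr → State → Maybe State
  exec (const r c) ⟨ pc , R , M , s ⟩ =
    just ⟨ suc pc , R [ r ≔ c mod2^ w ] , M , s ⟩
  exec (arith o r a b) ⟨ pc , R , M , s ⟩ =
    just ⟨ suc pc , R [ r ≔ evalArith o (R a) (R b) ] , M , s ⟩
  exec (bit o r a b) ⟨ pc , R , M , s ⟩ =
    just ⟨ suc pc , R [ r ≔ evalBit o (R a) (R b) ] , M , s ⟩
  exec (load r a) ⟨ pc , R , M , s ⟩ =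
    just ⟨ suc pc , R [ r ≔ M (R a mod2^ w) ] , M , s ⊔ suc (R a mod2^ w) ⟩
  exec (store a r) ⟨ pc , R , M , s ⟩ =
    just ⟨ suc pc , R , M [ R a mod2^ w ≔ R r ] , s ⊔ suc (R a mod2^ w) ⟩
  exec (jump l) ⟨ pc , R , M , s ⟩ =
    just ⟨ l , R , M , s ⟩
  exec (jlt a b l) ⟨ pc , R , M , s ⟩ =
    just ⟨ (if R a <ᵇ R b then l else suc pc) , R , M , s ⟩
  exec (jeq a b l) ⟨ pc , R , M , s ⟩ =
    just ⟨ (if R a ≡ᵇ R b then l else suc pc) , R , M , s ⟩
  exec halt _ = nothing

  -- nothing: the machine has halted, by halt or by leaving the program.
  step : Program → State → Maybe State
  step p s with p !? pc s
  ... | just i  = exec i s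
  ... | nothing = nothing

  -- p ⊢ s ⟶⟨ t ⟩ s′ : executing t instructions leads from s to s′.
  data _⊢_⟶⟨_⟩_ (p : Program) : State → ℕ → State → Set where
    done : ∀ {s} → p ⊢ s ⟶⟨ 0 ⟩ s
    next : ∀ {s s′ s″ t} →
           step p s ≡ just s′ → p ⊢ s′ ⟶⟨ t ⟩ s″ → p ⊢ s ⟶⟨ suc t ⟩ s″

  Halted : Program → State → Set
  Halted p s = step p s ≡ nothing

-- One-line notation with values in {1,…,m}.
oneLine : ∀ {m} → Permutation′ m → List ℕ
oneLine {m} ρ = map (λ i → suc (toℕ (ρ ⟨$⟩ʳ i))) (allFin m)

-- Memory initially contains n, k, σ(1),…,σ(n), π(1),…,π(k), followed by zeros.
initial : ∀ {n k} → Permutation′ n → Permutation′ k → State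
initial {n} {k} σ π =
  ⟨ 0 , (λ _ → 0) , (λ a → fromMaybe 0 ((n ∷ k ∷ oneLine σ ++ oneLine π) !? a)) , 0 ⟩

-- The program p, which is the same for all inputs and word sizes, outputs the
-- number of solutions in register 0, within time T n and space S n.  The word
-- length is w = Ω(log (n + k)), where c fixes the constant (a word can address
-- c * (n + k) cells), and the larger integers allowed in arithmetic need only be
-- large enough to represent the number of solutions.
CountsSolutionsWithin : (T S : ℕ → ℕ) → Program → ℕ → Set
CountsSolutionsWithin T S p c =
  ∀ n k .{{_ : NonZero n}} .{{_ : NonZero k}} (σ : Permutation′ n) (π : Permutation′ k) →
  ∀ w W → c * (n + k) ≤ 2 ^ w → w ≤ W → #solutions σ π < 2 ^ W →
  let open WordRAM w W in
  ∃[ t ] ∃[ s ] (p ⊢ initial σ π ⟶⟨ t ⟩ s) × Halted p s ×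
    reg s 0 ≡ #solutions σ π × t ≤ T n × space s ≤ S n

PPMSolvableWithin : (T S : ℕ → ℕ) → Set
PPMSolvableWithin T S = ∃[ p ] ∃[ c ] CountsSolutionsWithin T S p c

infix 4 _∈O_

_∈O_ : (ℕ → ℕ) → (ℕ → ℕ) → Set
f ∈O g = ∃[ C ] (∀ n .{{_ : NonZero n}} → f n ≤ C * g n)

{-# OPTIONS --safe #-}
module Submission where

open import Data.Bool using (true; false; if_then_else_; T)
open import Data.Bool.Properties using (T-≡)
open import Data.Fin using (Fin; toℕ; fromℕ<)
import Data.Fin as Fin
open import Data.Fin.Permutation using (Permutation′; _⟨$⟩ʳ_; _⟨$⟩ˡ_; inverseˡ; inverseʳ)
import Data.Fin.Properties as Fin
open import Data.List using (List; []; _∷_; _++_; map; filter; concat; length; applyUpTo; applyDownFrom; allFin)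
import Data.List as List
open import Data.List.Membership.Propositional using (_∈_)
open import Data.List.Membership.Propositional.Properties
open import Data.List.Membership.Propositional.Properties.WithK using (unique∧set⇒bag)
open import Data.List.Properties
  using (length-++; length-map; length-tabulate; map-tabulate; filter-none; ∷-injective; ∷-injectiveʳ; length-applyDownFrom)
open import Data.List.Relation.Binary.BagAndSetEquality using (∼bag⇒↭)
open import Data.List.Relation.Binary.Permutation.Propositional.Properties using (↭-length)
open import Data.List.Relation.Unary.All using ([]; _∷_; universal)
import Data.List.Relation.Unary.All.Properties as All
import Data.List.Relation.Unary.AllPairs.Properties as AllPairs
open import Data.List.Relation.Unary.Any using (here)
open import Data.List.Relation.Unary.Unique.Propositional using (Unique; []; _∷_)
import Data.List.Relation.Unary.Unique.Propositional.Properties as Unique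
open import Data.Maybe using (just; nothing; fromMaybe)
open import Data.Nat hiding (parity)
open import Data.Nat.DivMod hiding (_div_; _mod_)
open import Data.Nat.Divisibility using (n∣m*n)
open import Data.Nat.Properties
open import Data.Nat.Solver using (module +-*-Solver)
open import Data.Product using (Σ; _×_; _,_; ∃-syntax; proj₁; proj₂)
open import Data.Sum using (_⊎_; inj₁; inj₂)
open import Data.Unit using (⊤; tt)
open import Data.Vec using (Vec; lookup; tabulate; []; _∷_)
open import Data.Vec.Properties using (tabulate∘lookup; tabulate-cong; lookup∘tabulate)
open import Function using (_∘_; _$_; id)
open import Function.Bundles using (mk⇔; Equivalence)
open import Function.Definitions using (Injective)
open import Relation.Binary.Definitions using (tri<; tri≈; tri>)
open import Relation.Binary.PropositionalEquality
open import Relation.Nullary using (¬_; Dec; yes; no; contradiction)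
open import Relation.Nullary.Decidable using (does; _×-dec_)
open import Defs

-- Interchange the roles of positions and values: for a solution f let u a = σ (f (π⁻¹ a)) be the
-- value of σ that represents the value a of π, so that u is strictly increasing.  Cut the values of
-- σ into blocks {2b , 2b + 1} and let x be the set of the blocks that contain some u a with a odd.
-- Let rank x p be twice the number of blocks of x below p, plus one if p is the odd element of a
-- block of x.  Then rank x (u a) ≤ a ≤ rank x (u a + 1) for all a, and x is the only set of at most
-- k / 2 blocks with this property.  Conversely, every increasing f that has the property for some
-- set x is a solution: the ranges allowed for u a and u (a + 1) overlap in at most one value, and f
-- is injective.  Hence the solutions are counted by summing, over the 2 ^ (⌊n / 2⌋ + 1) sets x, the
-- number of increasing f that satisfy the inequalities.  As each value of σ can represent at most two
-- values of π, a scan of the positions of σ that counts partial solutions by their length takes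
-- constant time per position.  Partial counts may exceed the number of solutions, but it is enough to
-- know them modulo 2 ^ W.

-- Updates, comparisons and residues

≡ᵇ-refl : ∀ n → (n ≡ᵇ n) ≡ true
≡ᵇ-refl zero    = refl
≡ᵇ-refl (suc n) = ≡ᵇ-refl n

≢⇒≡ᵇ-false : ∀ {m n} → m ≢ n → (m ≡ᵇ n) ≡ false
≢⇒≡ᵇ-false {m} {n} m≢n with m ≡ᵇ n in eq
... | false = refl
... | true  = contradiction (≡ᵇ⇒≡ m n (Equivalence.from T-≡ eq)) m≢n

<⇒<ᵇ-true : ∀ {m n} → m < n → (m <ᵇ n) ≡ true
<⇒<ᵇ-true m<n = Equivalence.to T-≡ (<⇒<ᵇ m<n)

≮⇒<ᵇ-false : ∀ {m n} → ¬ m < n → (m <ᵇ n) ≡ false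
≮⇒<ᵇ-false {m} {n} m≮n with m <ᵇ n in eq
... | false = refl
... | true  = contradiction (<ᵇ⇒< m n (Equivalence.from T-≡ eq)) m≮n

updated : ∀ (g : ℕ → ℕ) a v → (g [ a ≔ v ]) a ≡ v
updated g a v rewrite ≡ᵇ-refl a = refl

unchanged : ∀ (g : ℕ → ℕ) {a x} v → x ≢ a → (g [ a ≔ v ]) x ≡ g x
unchanged g v x≢a rewrite ≢⇒≡ᵇ-false x≢a = refl

mod2^-small : ∀ {v} e → v < 2 ^ e → v mod2^ e ≡ v
mod2^-small e v<2^e = m<n⇒m%n≡m {{m^n≢0 2 e}} v<2^e

-- Uniqueness of quotient and remainder: different cells of the segments have different addresses,
-- so a store changes one cell of one segment only.
*+-injective : ∀ {L t i t′ i′} → i < L → i′ < L → t * L + i ≡ t′ * L + i′ → t ≡ t′ × i ≡ i′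
*+-injective {t = zero} {t′ = zero} _ _ eq = refl , eq
*+-injective {L} {zero} {i} {suc t′} {i′} i<L _ eq =
  contradiction (subst (_< L) eq i<L)
                (≤⇒≯ (≤-trans (m≤m+n L (t′ * L)) (m≤m+n (L + t′ * L) i′)))
*+-injective {L} {suc t} {i} {zero} {i′} _ i′<L eq =
  contradiction (subst (_< L) (sym eq) i′<L)
                (≤⇒≯ (≤-trans (m≤m+n L (t * L)) (m≤m+n (L + t * L) i)))
*+-injective {L} {suc t} {i} {suc t′} {i′} i<L i′<L eq
  with refl , i≡i′ ← *+-injective {L} {t} {i} {t′} {i′} i<L i′<L
         (+-cancelˡ-≡ L _ _ (trans (sym (+-assoc L (t * L) i)) (trans eq (+-assoc L (t′ * L) i′))))
  = refl , i≡i′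

-- Reasoning about runs of word RAM programs

-- Memory is viewed as five segments of L cells each.
Segments : Set
Segments = ℕ → ℕ → ℕ

_⟦_∣_≔_⟧ : Segments → ℕ → ℕ → ℕ → Segments
(a ⟦ t ∣ i ≔ v ⟧) u = if u ≡ᵇ t then a u [ i ≔ v ] else a u

-- A state without the space counter, its memory divided into segments.
record Config : Set where
  constructor ⟪_,_,_⟫
  field
    cpc  : ℕ
    creg : ℕ → ℕ
    seg  : Segments
open Config public

-- Matching on `at` turns the program counter into the literal `l`, so that each instruction fetch
-- below is proved by `refl`.
data At (l : ℕ) (P : (ℕ → ℕ) → Segments → Set) : Config → Set where
  at : ∀ {R a} → P R a → At l P ⟪ l , R , a ⟫

module Simulation (p : Program) (w W L : ℕ) .⦃ _ : NonZero L ⦄ (5L≤2^w : 5 * L ≤ 2 ^ w) (w≤W : w ≤ W) where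
  open WordRAM w W

  -- For a literal `t` the condition `T (t <ᵇ 5)` evaluates to the unit type, so wherever it is an
  -- implicit argument it is filled in automatically.
  Represents : (ℕ → ℕ) → Segments → Set
  Represents M a = ∀ t {i} → T (t <ᵇ 5) → i < L → M (t * L + i) ≡ a t i

  -- A Hoare triple for total correctness with a time bound, where staying within `5 * L` cells is a
  -- built-in invariant. Memories are compared with segments pointwise only, which avoids function
  -- extensionality.
  record _⇝[_]_ (c : Config) (t : ℕ) (Q : Config → Set) : Set where
    constructor reaches
    field
      reach : ∀ {M sp} → Represents M (seg c) → sp ≤ 5 * L →
        ∃[ c′ ] ∃[ M′ ] ∃[ sp′ ] ∃[ u ]
          (p ⊢ ⟨ cpc c , creg c , M , sp ⟩ ⟶⟨ u ⟩ ⟨ cpc c′ , creg c′ , M′ , sp′ ⟩)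
          × u ≤ t × Represents M′ (seg c′) × sp′ ≤ 5 * L × Q c′
  open _⇝[_]_ public

  stop : ∀ {c t Q} → Q c → c ⇝[ t ] Q
  stop q .reach rep sp≤ = _ , _ , _ , 0 , done , z≤n , rep , sp≤ , q

  ⟶-trans : ∀ {s s′ s″ t u} → p ⊢ s ⟶⟨ t ⟩ s′ → p ⊢ s′ ⟶⟨ u ⟩ s″ → p ⊢ s ⟶⟨ t + u ⟩ s″
  ⟶-trans done       y = y
  ⟶-trans (next e x) y = next e (⟶-trans x y)

  infixl 1 _then_
  _then_ : ∀ {c t u P Q} → c ⇝[ t ] P → (∀ {c} → P c → c ⇝[ u ] Q) → c ⇝[ t + u ] Q
  (x then f) .reach rep sp≤
    with _ , _ , _ , _ , r , b , rep′ , sp′≤ , q ← x .reach rep sp≤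
    with _ , _ , _ , _ , r′ , b′ , rep″ , sp″≤ , q′ ← f q .reach rep′ sp′≤
    = _ , _ , _ , _ , ⟶-trans r r′ , +-mono-≤ b b′ , rep″ , sp″≤ , q′

  -- The test that leaves the loop is not part of any of the `N` rounds; it is charged to whatever
  -- runs next.
  loop : ∀ {t} (I : ℕ → Config → Set) N →
         (∀ i {c} → i < N → I i c → c ⇝[ t ] I (suc i)) →
         ∀ {c} → I 0 c → c ⇝[ N * t ] I N
  loop {t} I N body = go N 0 (+-comm N 0)
    where
    go : ∀ m i → m + i ≡ N → ∀ {c} → I i c → c ⇝[ m * t ] I N
    go zero    i refl Ii = stop Ii
    go (suc m) i eq   Ii =
      body i (subst (suc i ≤_) eq (s≤s (m≤n+m i m))) Ii
        then go m (suc i) (trans (+-suc m i) eq)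

  address-< : ∀ {t i} → T (t <ᵇ 5) → i < L → t * L + i < 5 * L
  address-< {t} {i} t<5 i<L = begin-strict
    t * L + i <⟨ +-monoʳ-< (t * L) i<L ⟩
    t * L + L ≡⟨ +-comm (t * L) L ⟩
    suc t * L ≤⟨ *-monoˡ-≤ L (<ᵇ⇒< t 5 t<5) ⟩
    5 * L     ∎
    where open ≤-Reasoning

  <5L⇒<2^w : ∀ {v} → v < 5 * L → v < 2 ^ w
  <5L⇒<2^w v<5L = <-≤-trans v<5L 5L≤2^w

  <5L⇒<2^W : ∀ {v} → v < 5 * L → v < 2 ^ W
  <5L⇒<2^W v<5L = <-≤-trans (<5L⇒<2^w v<5L) (^-monoʳ-≤ 2 w≤W)

  step≡ : ∀ {i s} → p !? pc s ≡ just i → step p s ≡ exec i s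
  step≡ {s = s} eq with p !? pc s | eq
  ... | just _ | refl = refl

  -- The rest of the run is the last argument, here and in the rules for the single instructions.
  -- Chained with `$`, they make a correctness proof read like the program listing.
  pure-step : ∀ {i pc pc′ R R′ a Q t} → p !? pc ≡ just i →
    (∀ {M sp} → exec i ⟨ pc , R , M , sp ⟩ ≡ just ⟨ pc′ , R′ , M , sp ⟩) →
    ⟪ pc′ , R′ , a ⟫ ⇝[ t ] Q → ⟪ pc , R , a ⟫ ⇝[ suc t ] Q
  pure-step fetch eq x .reach rep sp≤
    with _ , _ , _ , _ , r , b , rest ← x .reach rep sp≤
    = _ , _ , _ , _ , next (trans (step≡ fetch) eq) r , s≤s b , rest

  step-const : ∀ {pc r v R a Q t} → p !? pc ≡ just (const r v) → {T (v <ᵇ 5)} →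
    ⟪ suc pc , R [ r ≔ v ] , a ⟫ ⇝[ t ] Q → ⟪ pc , R , a ⟫ ⇝[ suc t ] Q
  step-const {r = r} {v} {R} fetch {v<5} = pure-step fetch
    (cong (λ u → just ⟨ _ , R [ r ≔ u ] , _ , _ ⟩)
      (mod2^-small w (<5L⇒<2^w (<-≤-trans (<ᵇ⇒< v 5 v<5) (*-monoʳ-≤ 5 (>-nonZero⁻¹ L))))))

  step-arith : ∀ {pc o r x y v R a Q t} → p !? pc ≡ just (arith o r x y) →
    evalArith o (R x) (R y) ≡ v →
    ⟪ suc pc , R [ r ≔ v ] , a ⟫ ⇝[ t ] Q → ⟪ pc , R , a ⟫ ⇝[ suc t ] Q
  step-arith {r = r} {R = R} fetch eq = pure-step fetch
    (cong (λ u → just ⟨ _ , R [ r ≔ u ] , _ , _ ⟩) eq)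

  step-jump : ∀ {pc l R a Q t} → p !? pc ≡ just (jump l) →
    ⟪ l , R , a ⟫ ⇝[ t ] Q → ⟪ pc , R , a ⟫ ⇝[ suc t ] Q
  step-jump fetch = pure-step fetch refl

  step-jlt : ∀ {pc x y l R a Q t b} → p !? pc ≡ just (jlt x y l) → (R x <ᵇ R y) ≡ b →
    ⟪ (if b then l else suc pc) , R , a ⟫ ⇝[ t ] Q → ⟪ pc , R , a ⟫ ⇝[ suc t ] Q
  step-jlt {pc} {l = l} {R} fetch eq = pure-step fetch
    (cong (λ b → just ⟨ (if b then l else suc pc) , R , _ , _ ⟩) eq)

  step-jeq : ∀ {pc x y l R a Q t b} → p !? pc ≡ just (jeq x y l) → (R x ≡ᵇ R y) ≡ b →
    ⟪ (if b then l else suc pc) , R , a ⟫ ⇝[ t ] Q → ⟪ pc , R , a ⟫ ⇝[ suc t ] Q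
  step-jeq {pc} {l = l} {R} fetch eq = pure-step fetch
    (cong (λ b → just ⟨ (if b then l else suc pc) , R , _ , _ ⟩) eq)

  step-load : ∀ {pc r x R a Q t} → p !? pc ≡ just (load r x) →
    ∀ u {i} {u<5 : T (u <ᵇ 5)} → R x ≡ u * L + i → i < L →
    ⟪ suc pc , R [ r ≔ a u i ] , a ⟫ ⇝[ t ] Q → ⟪ pc , R , a ⟫ ⇝[ suc t ] Q
  step-load {pc} {r} {x} {R} {a} fetch u {i} {u<5} eq i<L k .reach {M} {sp} rep sp≤
    with _ , _ , _ , _ , run , b , rest ← k .reach rep (⊔-lub sp≤ (address-< {u} u<5 i<L))
    = _ , _ , _ , _ , next (trans (step≡ fetch) e) run , s≤s b , rest
    where
    addr≡ : R x mod2^ w ≡ u * L + i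
    addr≡ = trans (cong (_mod2^ w) eq) (mod2^-small w (<5L⇒<2^w (address-< {u} u<5 i<L)))
    e : exec (load r x) ⟨ pc , R , M , sp ⟩
        ≡ just ⟨ suc pc , R [ r ≔ a u i ] , M , sp ⊔ suc (u * L + i) ⟩
    e rewrite addr≡ | rep u {i} u<5 i<L = refl

  Represents-store : ∀ {M a u i} v → T (u <ᵇ 5) → i < L → Represents M a →
    Represents (M [ u * L + i ≔ v ]) (a ⟦ u ∣ i ≔ v ⟧)
  Represents-store {M} {a} {u} {i} v u<5 i<L rep u′ {i′} u′<5 i′<L with u′ ≟ u
  ... | no u′≢u rewrite ≢⇒≡ᵇ-false u′≢u =
    trans (unchanged M v (λ eq → u′≢u (proj₁ (*+-injective {t = u′} {t′ = u} i′<L i<L eq)))) (rep u′ u′<5 i′<L)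
  ... | yes refl rewrite ≡ᵇ-refl u with i′ ≟ i
  ...   | no i′≢i rewrite ≢⇒≡ᵇ-false i′≢i =
    trans (unchanged M v (i′≢i ∘ +-cancelˡ-≡ (u * L) i′ i)) (rep u′ u′<5 i′<L)
  ...   | yes refl rewrite ≡ᵇ-refl i = updated M (u * L + i) v

  step-store : ∀ {pc r x R a Q t} → p !? pc ≡ just (store x r) →
    ∀ u {i v} {u<5 : T (u <ᵇ 5)} → R x ≡ u * L + i → i < L → R r ≡ v →
    ⟪ suc pc , R , a ⟦ u ∣ i ≔ v ⟧ ⟫ ⇝[ t ] Q → ⟪ pc , R , a ⟫ ⇝[ suc t ] Q
  step-store {pc} {r} {x} {R} {a} fetch u {i} {v} {u<5} eq i<L refl k .reach {M} {sp} rep sp≤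
    with _ , _ , _ , _ , run , b , rest ←
      k .reach (Represents-store {M} {a} {u} (R r) u<5 i<L rep) (⊔-lub sp≤ (address-< {u} u<5 i<L))
    = _ , _ , _ , _ , next (trans (step≡ fetch) e) run , s≤s b , rest
    where
    addr≡ : R x mod2^ w ≡ u * L + i
    addr≡ = trans (cong (_mod2^ w) eq) (mod2^-small w (<5L⇒<2^w (address-< {u} u<5 i<L)))
    e : exec (store x r) ⟨ pc , R , M , sp ⟩
        ≡ just ⟨ suc pc , R , M [ u * L + i ≔ R r ] , sp ⊔ suc (u * L + i) ⟩
    e rewrite addr≡ = refl

  add≡ : ∀ {x y x′ y′ v} → x ≡ x′ → y ≡ y′ → x′ + y′ ≡ v → v < 5 * L → evalArith add x y ≡ v
  add≡ refl refl refl v<5L = mod2^-small W (<5L⇒<2^W v<5L)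

-- The numbers computed by the program

halves : ℕ → ℕ → ℕ
halves zero    x = x
halves (suc b) x = halves b x / 2

digit : ℕ → ℕ → ℕ
digit b x = halves b x % 2

digit-≤1 : ∀ b x → digit b x ≤ 1
digit-≤1 b x = ≤-pred (m%n<n (halves b x) 2)

-- A set of blocks {2b , 2b + 1} is encoded by the number x whose binary digit b tells whether the
-- block b belongs to the set.
rank : ℕ → ℕ → ℕ
rank x zero    = 0
rank x (suc p) = rank x p + digit ⌊ p /2⌋ x

-- Both arguments and values of the inverse are shifted by one, and 0 stands for undefined.
inverseTable : (ℕ → ℕ) → ℕ → ℕ → ℕ
inverseTable f zero    = λ _ → 0
inverseTable f (suc i) = inverseTable f i [ suc (f i) ≔ suc i ]

Σ< : ℕ → (ℕ → ℕ) → ℕ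
Σ< zero    f = 0
Σ< (suc n) f = Σ< n f + f n

-- As in the program, r i and r j are read before either cell is changed.
addBoth : (ℕ → ℕ) → (i j d : ℕ) → ℕ → ℕ
addBoth r i j d = r₁ [ suc j ≔ r₁ (suc j) + r j * d ]
  where
  r₁ : ℕ → ℕ
  r₁ = r [ suc i ≔ r (suc i) + r i ]

module Table (σ table : ℕ → ℕ) (x : ℕ) where
  -- Cell j + 1 of row t counts the increasing sequences of length j of positions below t that respect
  -- x.  Cell 0 is always 0: it absorbs the undefined values of table.
  row : ℕ → ℕ → ℕ
  row zero    = (λ _ → 0) [ 1 ≔ 1 ]
  row (suc t) = addBoth (row t) (table (suc (rank x (σ t)))) (table (suc (rank x (suc (σ t)))))
                        (digit ⌊ σ t /2⌋ x)

  -- The comparison is between successors because it mirrors the registers, which hold `k + 1` and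
  -- the rank plus 1. It rejects the sets with more than `k / 2` blocks.
  fittings# : (n k h : ℕ) → ℕ
  fittings# n k h = if suc k <ᵇ suc (rank x (h + h)) then 0 else row n (suc k)

-- Bounds and binary arithmetic

rank-≤ : ∀ x p → rank x p ≤ p
rank-≤ x zero    = z≤n
rank-≤ x (suc p) = begin
  rank x p + digit ⌊ p /2⌋ x ≤⟨ +-mono-≤ (rank-≤ x p) (digit-≤1 ⌊ p /2⌋ x) ⟩
  p + 1                      ≡⟨ +-comm p 1 ⟩
  suc p                      ∎
  where open ≤-Reasoning

inverseTable-≤ : ∀ f i v → inverseTable f i v ≤ i
inverseTable-≤ f zero    v = z≤n
inverseTable-≤ f (suc i) v with v ≡ᵇ suc (f i)
... | true  = ≤-refl
... | false = m≤n⇒m≤1+n (inverseTable-≤ f i v)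

halves-suc : ∀ b x → halves (suc b) x ≡ halves b (x / 2)
halves-suc zero    x = refl
halves-suc (suc b) x = cong (_/ 2) (halves-suc b x)

halves-< : ∀ b {x} → x < 2 ^ b → halves b x ≡ 0
halves-< zero    (s≤s z≤n) = refl
halves-< (suc b) {x} x< = trans (halves-suc b x)
  (halves-< b (m<n*o⇒m/o<n (subst (x <_) (*-comm 2 (2 ^ b)) x<)))

-- With `halves-<`, this is the exit test over all masks: the carry out of `h` digits is 0 for every
-- `x < 2 ^ h` and becomes 1 at `x = 2 ^ h`.
halves-2^ : ∀ b → halves b (2 ^ b) ≡ 1
halves-2^ zero    = refl
halves-2^ (suc b) = trans (halves-suc b (2 * 2 ^ b))
  (trans (cong (halves b) (trans (cong (_/ 2) (*-comm 2 (2 ^ b))) (m*n/n≡m (2 ^ b) 2))) (halves-2^ b))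

-- Schoolbook addition of a carry `c` to `y`: the carry passed on to the next digit makes the halves
-- agree, and `carry-%` gives the new digit. The scan increments `x` in place in this way.
carry-/ : ∀ y c → y / 2 + (c + y % 2) / 2 ≡ (y + c) / 2
carry-/ y c = sym (begin
  (y + c) / 2                   ≡⟨ cong (λ v → (v + c) / 2) (m≡m%n+[m/n]*n y 2) ⟩
  (y % 2 + y / 2 * 2 + c) / 2   ≡⟨ cong (_/ 2) (solve 3 (λ r q c → r :+ q :+ c := q :+ (c :+ r)) refl (y % 2) (y / 2 * 2) c) ⟩
  (y / 2 * 2 + (c + y % 2)) / 2 ≡⟨ +-distrib-/-∣ˡ (c + y % 2) (n∣m*n (y / 2)) ⟩
  y / 2 * 2 / 2 + (c + y % 2) / 2 ≡⟨ cong (_+ (c + y % 2) / 2) (m*n/n≡m (y / 2) 2) ⟩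
  y / 2 + (c + y % 2) / 2       ∎)
  where open ≡-Reasoning
        open +-*-Solver

carry-% : ∀ y c → (c + y % 2) % 2 ≡ (y + c) % 2
carry-% y c = begin
  (c + y % 2) % 2           ≡⟨ %-distribˡ-+ c (y % 2) 2 ⟩
  (c % 2 + y % 2 % 2) % 2   ≡⟨ cong (λ v → (c % 2 + v) % 2) (m%n%n≡m%n y 2) ⟩
  (c % 2 + y % 2) % 2       ≡⟨ sym (%-distribˡ-+ c y 2) ⟩
  (c + y) % 2               ≡⟨ cong (_% 2) (+-comm c y) ⟩
  (y + c) % 2               ∎
  where open ≡-Reasoning

-- The program

-- With L = 2 (n + 1) and h = ⌊n / 2⌋ + 1, registers are used as follows: 0 sum of the counts so far,
-- 1 n, 2 k, 3 L, 4 one, 5 two, 6 k + 1, 7 to 9 addresses 2L, 3L, 4L, 10 h, 11 loop variable,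
-- 12 current rank plus 1, 13 carry; register 15 is never written and holds 0.  The segments are:
-- 0 input, 1 inverse of π, 2 digits of x, 3 ranks, 4 current row.
countSolutions : Program
countSolutions =
    const 4 1
  ∷ const 5 2
  ∷ load 1 15
  ∷ load 2 4
  -- A pattern longer than `n` has no solutions, and register 0 still holds 0. Otherwise
  -- `2 + n + k ≤ L`, so the input fits into segment 0.
  ∷ jlt 1 2 81
  ∷ arith add 3 1 4
  ∷ arith mul 3 3 5
  ∷ arith add 6 2 4
  ∷ arith add 7 3 3
  ∷ arith add 8 3 7
  ∷ arith add 9 7 7
  ∷ arith div 10 1 5
  ∷ arith add 10 4 10
  -- 13: invert π
  ∷ jeq 11 2 21
  ∷ arith add 12 5 11
  ∷ arith add 12 1 12
  ∷ load 14 12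
  ∷ arith add 14 3 14
  ∷ arith add 11 4 11
  ∷ store 14 11
  ∷ jump 13
  -- 21: next mask x
  ∷ jeq 13 4 81
  ∷ const 11 0
  ∷ const 12 1
  -- The initial carry 1 is what turns `x` into `x + 1` during the scan.
  ∷ const 13 1
  -- 25: store the ranks, clear the row and increment x
  ∷ jeq 11 10 46
  ∷ arith add 14 11 11
  ∷ arith add 14 4 14
  ∷ arith add 16 8 14
  ∷ store 16 12
  ∷ arith add 17 9 14
  ∷ store 17 15
  ∷ arith add 18 7 11
  ∷ load 19 18
  ∷ arith add 12 12 19
  ∷ arith add 16 4 16
  ∷ store 16 12
  ∷ arith add 17 4 17
  ∷ store 17 15
  ∷ arith add 12 12 19
  ∷ arith add 13 13 19
  ∷ arith mod 14 13 5
  ∷ store 18 14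
  ∷ arith div 13 13 5
  ∷ arith add 11 4 11
  ∷ jump 25
  -- 46: row 0
  ∷ arith add 16 9 4
  ∷ store 16 4
  ∷ const 11 0
  -- 49: from row t to row t + 1
  ∷ jeq 11 1 76
  ∷ arith add 16 5 11
  ∷ load 14 16
  ∷ arith add 14 8 14
  ∷ load 16 14
  ∷ arith add 14 4 14
  ∷ load 17 14
  -- Segment 2 already holds the digits of `x + 1`; the digit of `x` is recovered as the difference
  -- of two consecutive ranks.
  ∷ arith sub 18 17 16
  ∷ arith add 16 3 16
  ∷ load 16 16
  ∷ arith add 17 3 17
  ∷ load 17 17
  ∷ arith add 16 9 16
  ∷ load 14 16
  ∷ arith add 17 9 17
  ∷ load 19 17
  ∷ arith mul 19 19 18
  ∷ arith add 16 4 16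
  ∷ load 20 16
  ∷ arith add 20 20 14
  ∷ store 16 20
  ∷ arith add 17 4 17
  ∷ load 20 17
  ∷ arith add 20 20 19
  ∷ store 17 20
  ∷ arith add 11 4 11
  ∷ jump 49
  -- 76: add up, unless x has more than k / 2 blocks
  ∷ jlt 6 12 80
  ∷ arith add 16 9 6
  ∷ load 16 16
  ∷ arith add 0 0 16
  ∷ jump 21
  ∷ halt
  ∷ []

-- Correctness of the program

module Correct
  (n k w W L h : ℕ) (σ π : ℕ → ℕ)
  (L≡ : suc n * 2 ≡ L) (h≡ : suc (n / 2) ≡ h)
  (0<n : 0 < n) (0<k : 0 < k) (k≤n : k ≤ n)
  (σ<n : ∀ {t} → t < n → σ t < n) (π<k : ∀ {i} → i < k → π i < k)
  (5L≤2^w : 5 * L ≤ 2 ^ w) (w≤W : w ≤ W)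
  where

  2+n<L : suc (suc n) < L
  2+n<L = begin-strict
    suc (suc n)     <⟨ +-monoʳ-< 2 (m<m*n n 2 {{>-nonZero 0<n}} (s≤s (s≤s z≤n))) ⟩
    suc n * 2       ≡⟨ L≡ ⟩
    L               ∎
    where open ≤-Reasoning

  open WordRAM w W
  open Simulation countSolutions w W L ⦃ >-nonZero (≤-<-trans z≤n 2+n<L) ⦄ 5L≤2^w w≤W

  small : ∀ {v} → v ≤ suc (suc n) → v < L
  small v≤ = ≤-<-trans v≤ 2+n<L

  ≤L⇒<5L : ∀ {v} → v ≤ L → v < 5 * L
  ≤L⇒<5L {v} v≤L = begin-strict
    v          ≤⟨ v≤L ⟩
    L          ≡⟨ +-identityʳ L ⟨
    1 * L      <⟨ *-monoˡ-< L {{>-nonZero (≤-<-trans z≤n 2+n<L)}} {1} {5} (s≤s (s≤s z≤n)) ⟩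
    5 * L      ∎
    where open ≤-Reasoning

  small-5L : ∀ {v} → v ≤ suc (suc n) → v < 5 * L
  small-5L v≤ = ≤L⇒<5L (<⇒≤ (small v≤))

  h+h≤ : h + h ≤ suc (suc n)
  h+h≤ = begin
    h + h                      ≡⟨ cong (λ v → v + v) (sym h≡) ⟩
    suc (n / 2 + suc (n / 2))  ≡⟨ cong suc (+-suc (n / 2) (n / 2)) ⟩
    2 + (n / 2 + n / 2)        ≡⟨ cong (λ v → 2 + (n / 2 + v)) (sym (+-identityʳ (n / 2))) ⟩
    2 + 2 * (n / 2)            ≡⟨ cong (2 +_) (*-comm 2 (n / 2)) ⟩
    2 + n / 2 * 2              ≤⟨ +-monoʳ-≤ 2 (m/n*n≤m n 2) ⟩
    2 + n                      ∎
    where open ≤-Reasoning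

  n<h+h : n < h + h
  n<h+h = begin-strict
    n                       ≡⟨ m≡m%n+[m/n]*n n 2 ⟩
    n % 2 + n / 2 * 2       <⟨ +-monoˡ-< (n / 2 * 2) (m%n<n n 2) ⟩
    2 + n / 2 * 2           ≡⟨ *-comm (suc (n / 2)) 2 ⟩
    2 * suc (n / 2)         ≡⟨ cong (2 *_) h≡ ⟩
    h + (h + 0)             ≡⟨ cong (h +_) (+-identityʳ h) ⟩
    h + h                   ∎
    where open ≤-Reasoning

  b+b< : ∀ {b} → b < h → suc (suc (b + b)) ≤ suc (suc n)
  b+b< {b} b<h = ≤-trans (subst (_≤ h + h) (cong suc (+-suc b b)) (+-mono-≤ b<h b<h)) h+h≤

  h≤ : h ≤ suc (suc n)
  h≤ = ≤-trans (m≤m+n h h) h+h≤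

  infix 4 _≋_
  -- Deliberately not symmetric: the left side is the residue that the machine holds, the right side
  -- the exact count, which may be `2 ^ W` or more.
  _≋_ : ℕ → ℕ → Set
  u ≋ v = u ≡ v mod2^ W

  private instance _ = m^n≢0 2 W

  ≋-add : ∀ {a b u v} → a ≋ u → b ≋ v → evalArith add a b ≋ (u + v)
  ≋-add {u = u} {v} refl refl = sym (trans (cong (_% 2 ^ W) refl) (%-distribˡ-+ u v (2 ^ W)))

  ≋-mul : ∀ {a b u v} → a ≋ u → b ≡ v → evalArith mul a b ≋ (u * v)
  ≋-mul {u = u} {v} refl refl = begin
    u % 2 ^ W * v % 2 ^ W                               ≡⟨ %-distribˡ-* (u % 2 ^ W) v (2 ^ W) ⟩
    (u % 2 ^ W % 2 ^ W) * (v % 2 ^ W) % 2 ^ W           ≡⟨ cong (λ z → z * (v % 2 ^ W) % 2 ^ W) (m%n%n≡m%n u (2 ^ W)) ⟩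
    (u % 2 ^ W) * (v % 2 ^ W) % 2 ^ W                   ≡⟨ %-distribˡ-* u v (2 ^ W) ⟨
    u * v % 2 ^ W                                       ∎
    where open ≡-Reasoning

  ≋-update : ∀ {g r : ℕ → ℕ} {i u v B} → (∀ s → s ≤ B → g s ≋ r s) → u ≋ v →
    ∀ s → s ≤ B → (g [ i ≔ u ]) s ≋ (r [ i ≔ v ]) s
  ≋-update {i = i} g≋r u≋v s s≤B with s ≡ᵇ i
  ... | true  = u≋v
  ... | false = g≋r s s≤B

  sub≡ : ∀ {x y u d} → y ≡ u → x ≡ u + d → u + d < 5 * L → evalArith sub x y ≡ d
  sub≡ {u = u} {d} refl refl u+d< = begin
    (u + d + (2 ^ W ∸ u)) % 2 ^ W   ≡⟨ cong (_% 2 ^ W) (cong (_+ (2 ^ W ∸ u)) (+-comm u d)) ⟩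
    (d + u + (2 ^ W ∸ u)) % 2 ^ W   ≡⟨ cong (_% 2 ^ W) (+-assoc d u _) ⟩
    (d + (u + (2 ^ W ∸ u))) % 2 ^ W ≡⟨ cong (λ z → (d + z) % 2 ^ W)
                                        (m+[n∸m]≡n (<⇒≤ (≤-<-trans (m≤m+n u d) (<5L⇒<2^W u+d<)))) ⟩
    (d + 2 ^ W) % 2 ^ W             ≡⟨ [m+n]%n≡m%n d (2 ^ W) ⟩
    d % 2 ^ W                       ≡⟨ mod2^-small W (≤-<-trans (m≤n+m d u) (<5L⇒<2^W u+d<)) ⟩
    d                               ∎
    where open ≡-Reasoning

  div≡ : ∀ {x y} → y ≡ 2 → evalArith div x y ≡ x / 2
  div≡ refl = refl

  mod≡ : ∀ {x y} → y ≡ 2 → evalArith mod x y ≡ x % 2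
  mod≡ refl = refl

  table : ℕ → ℕ
  table = inverseTable π k

  open Table σ table

  count : ℕ → ℕ
  count x = fittings# x n k h

  Fixed : (ℕ → ℕ) → Segments → Set
  Fixed R a =
    (R 1 ≡ n × R 2 ≡ k × R 3 ≡ 1 * L × R 4 ≡ 1 × R 5 ≡ 2 × R 6 ≡ suc k)
    × (R 7 ≡ 2 * L × R 8 ≡ 3 * L × R 9 ≡ 4 * L × R 10 ≡ h × R 15 ≡ 0)
    × (∀ t → t < n → a 0 (2 + t) ≡ suc (σ t)) × a 4 0 ≡ 0

  Inverted : Segments → Set
  Inverted a = ∀ v → v < L → a 1 v ≡ table v

  -- The invariants Setup, Masks, Scan and Rows hold at the heads of the loops at 13, 21, 25 and 49.
  Setup : ℕ → (ℕ → ℕ) → Segments → Set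
  Setup i R a = Fixed R a
    × R 0 ≡ 0 × R 11 ≡ i × R 13 ≡ 0
    × (∀ j → j < k → a 0 (n + (2 + j)) ≡ suc (π j))
    × (∀ v → v < L → a 1 v ≡ inverseTable π i v)
    × (∀ b → b < h → a 2 b ≡ 0)

  Masks : ℕ → (ℕ → ℕ) → Segments → Set
  Masks x R a = Fixed R a × Inverted a
    × R 0 ≋ Σ< x count
    × (∀ b → b < h → a 2 b ≡ digit b x)
    × R 13 ≡ halves h x

  Scan : ℕ → ℕ → (ℕ → ℕ) → Segments → Set
  Scan x b R a = Fixed R a × Inverted a
    × R 0 ≋ Σ< x count
    × R 11 ≡ b
    × R 12 ≡ suc (rank x (b + b))
    -- The increment has reached digit `b`: register 13 is the carry into it, the digits below are
    -- those of `x + 1`, and the others are still those of `x`.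
    × R 13 ≤ 1 × halves b x + R 13 ≡ halves b (suc x)
    × (∀ c → c < b → a 2 c ≡ digit c (suc x))
    × (∀ c → b ≤ c → c < h → a 2 c ≡ digit c x)
    × (∀ p → p < b + b → a 3 (suc p) ≡ suc (rank x p))
    × (∀ s → s < suc (b + b) → a 4 s ≡ 0)

  Rows : ℕ → ℕ → (ℕ → ℕ) → Segments → Set
  Rows x t R a = Fixed R a × Inverted a
    × R 0 ≋ Σ< x count
    × R 11 ≡ t
    × R 12 ≡ suc (rank x (h + h))
    × R 13 ≡ halves h (suc x)
    × (∀ c → c < h → a 2 c ≡ digit c (suc x))
    × (∀ p → p < h + h → a 3 (suc p) ≡ suc (rank x p))
    × (∀ s → s ≤ suc k → a 4 s ≋ row x t s)


  extend : ∀ {g f : ℕ → ℕ} {m v} → (∀ s → s < m → g s ≡ f s) → v ≡ f m →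
    ∀ s → s < suc m → (g [ m ≔ v ]) s ≡ f s
  extend {g} {m = m} {v} g≡f v≡ s s<1+m with s ≟ m
  ... | yes refl = trans (updated g s v) v≡
  ... | no  s≢m  = trans (unchanged g v s≢m) (g≡f s (≤∧≢⇒< (≤-pred s<1+m) s≢m))

  update-cong : ∀ (g f : ℕ → ℕ) {i v} s → g s ≡ f s → (g [ i ≔ v ]) s ≡ (f [ i ≔ v ]) s
  update-cong g f {i} s eq with s ≡ᵇ i
  ... | true  = refl
  ... | false = eq

  setup-step : ∀ i {c} → i < k → At 13 (Setup i) c → c ⇝[ 8 ] At 13 (Setup (suc i))
  setup-step i i<k (at {R} {a} (fx@((n≡ , k≡ , L₁ , one , two , _) , _) , zero≡ , i≡ , c≡ , π≡ , table≡ , bits)) =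
      step-jeq refl (trans (cong₂ _≡ᵇ_ i≡ k≡) (≢⇒≡ᵇ-false (<⇒≢ i<k))) $
      step-arith refl (add≡ two i≡ refl (small-5L (s≤s (s≤s i≤n)))) $
      step-arith refl (add≡ n≡ refl refl (address-< {0} _ input<)) $
      step-load refl 0 refl input< $
      step-arith refl (add≡ L₁ (π≡ i i<k) refl (address-< {1} _ π<)) $
      step-arith refl (add≡ one i≡ refl (small-5L (m≤n⇒m≤1+n (s≤s i≤n)))) $
      step-store refl 1 refl π< refl $
      step-jump refl $
      stop (at (fx , zero≡ , refl , c≡ , π≡ , (λ v v<L → update-cong (a 1) (inverseTable π i) v (table≡ v v<L)) , bits))
    where
    i≤n : i ≤ n
    i≤n = <⇒≤ (<-≤-trans i<k k≤n)
    input< : n + (2 + i) < L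
    input< = begin-strict
      n + (2 + i)     <⟨ +-monoʳ-< n (+-monoʳ-< 2 (<-≤-trans i<k k≤n)) ⟩
      n + (2 + n)     ≡⟨ +-comm n (2 + n) ⟩
      2 + (n + n)     ≡⟨ cong (2 +_) (cong (n +_) (sym (+-identityʳ n))) ⟩
      2 + 2 * n       ≡⟨ cong (2 +_) (*-comm 2 n) ⟩
      suc n * 2       ≡⟨ L≡ ⟩
      L               ∎
      where open ≤-Reasoning
    π< : suc (π i) < L
    π< = small (m≤n⇒m≤1+n (≤-trans (π<k i<k) (m≤n⇒m≤1+n k≤n)))

  scan-step : ∀ x b {c} → b < h → At 25 (Scan x b) c → c ⇝[ 21 ] At 25 (Scan x (suc b))
  scan-step x b b<h (at {R} {a} (fx@((_ , _ , _ , one , two , _) , (L₂ , L₃ , L₄ , h≡ , nul) , _ , _) , inv , total ,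
      b≡ , r≡ , c≤1 , carry , low , high , ranks , zeros)) =
      step-jeq refl (trans (cong₂ _≡ᵇ_ b≡ h≡) (≢⇒≡ᵇ-false (<⇒≢ b<h))) $
      step-arith refl (add≡ b≡ b≡ refl (small-5L (<⇒≤ (<⇒≤ 2+b+b≤)))) $
      step-arith refl (add≡ one refl refl (small-5L (<⇒≤ 2+b+b≤))) $
      step-arith refl (add≡ L₃ refl refl (address-< {3} _ (small (<⇒≤ 2+b+b≤)))) $
      step-store refl 3 refl (small (<⇒≤ 2+b+b≤)) r≡ $
      step-arith refl (add≡ L₄ refl refl (address-< {4} _ (small (<⇒≤ 2+b+b≤)))) $
      step-store refl 4 refl (small (<⇒≤ 2+b+b≤)) nul $
      step-arith refl (add≡ L₂ b≡ refl (address-< {2} _ b<L)) $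
      step-load refl 2 refl b<L $
      step-arith refl (add≡ r≡ bit≡₁ refl (≤L⇒<5L (rank≤ (suc (b + b)) (<⇒≤ 2+b+b≤)))) $
      step-arith refl (add≡ one refl (sym (+-suc (3 * L) (suc (b + b)))) (address-< {3} _ (small 2+b+b≤))) $
      step-store refl 3 refl (small 2+b+b≤) refl $
      step-arith refl (add≡ one refl (sym (+-suc (4 * L) (suc (b + b)))) (address-< {4} _ (small 2+b+b≤))) $
      step-store refl 4 refl (small 2+b+b≤) nul $
      step-arith refl (add≡ refl bit≡₂ refl (≤L⇒<5L (rank≤ (suc (suc (b + b))) 2+b+b≤))) $
      step-arith refl (add≡ refl bit≡ refl (small-5L (≤-trans s≤2 (m≤m+n 2 n)))) $
      step-arith refl (trans (mod≡ two) (trans (carry-% (halves b x) (R 13)) (cong (_% 2) carry))) $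
      step-store refl 2 refl b<L refl $
      step-arith refl (div≡ two) $
      step-arith refl (add≡ one b≡ refl (small-5L (≤-trans b<h h≤))) $
      step-jump refl $
      stop (at (fx , inv , total , refl , cong (λ m → suc (rank x m)) (sym eq) ,
        /-monoˡ-≤ 2 s≤2 , trans (carry-/ (halves b x) (R 13)) (cong (_/ 2) carry) ,
        extend low refl ,
        (λ c b<c c<h → trans (unchanged (a 2) _ (<⇒≢ b<c ∘ sym)) (high c (<⇒≤ b<c) c<h)) ,
        (λ p p< → extend {g = λ p → (a 3 [ suc (b + b) ≔ _ ]) (suc p)} (extend {g = a 3 ∘ suc} ranks refl) refl p
                    (subst (p <_) eq p<)) ,
        (λ s s< → extend (extend zeros refl) refl s (subst (λ m → s < suc m) eq s<))))
    where
    eq : suc b + suc b ≡ suc (suc (b + b))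
    eq = cong suc (+-suc b b)
    2+b+b≤ : suc (suc (b + b)) ≤ suc (suc n)
    2+b+b≤ = b+b< b<h
    b<L : b < L
    b<L = small (≤-trans (<⇒≤ b<h) h≤)
    rank≤ : ∀ p → p ≤ suc (suc n) → suc (rank x p) ≤ L
    rank≤ p p≤ = small (≤-trans (rank-≤ x p) p≤)
    bit≡ : a 2 b ≡ digit b x
    bit≡ = high b ≤-refl b<h
    bit≡₁ : a 2 b ≡ digit ⌊ b + b /2⌋ x
    bit≡₁ = trans bit≡ (cong (λ c → digit c x) (n≡⌊n+n/2⌋ b))
    bit≡₂ : a 2 b ≡ digit ⌊ suc (b + b) /2⌋ x
    bit≡₂ = trans bit≡ (cong (λ c → digit c x) (n≡⌈n+n/2⌉ b))
    s≤2 : R 13 + digit b x ≤ 2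
    s≤2 = +-mono-≤ c≤1 (≤-pred (m%n<n (halves b x) 2))

  row-step : ∀ x t {c} → t < n → At 49 (Rows x t) c → c ⇝[ 27 ] At 49 (Rows x (suc t))
  row-step x t t<n (at {R} {a} (fx@((n≡ , k≡ , L₁ , one , two , _) , (L₂ , L₃ , L₄ , h≡ , nul) , input , _) ,
                          inv , total , t≡ , r≡ , c≡ , bits , ranks , rows)) =
      step-jeq refl (trans (cong₂ _≡ᵇ_ t≡ n≡) (≢⇒≡ᵇ-false (<⇒≢ t<n))) $
      step-arith refl (add≡ two t≡ refl (small-5L (s≤s 1+t≤1+n))) $
      step-load refl 0 refl (small (s≤s 1+t≤1+n)) $
      step-arith refl (add≡ L₃ (input t t<n) refl (address-< {3} _ (small 1+q≤))) $
      step-load refl 3 refl (small 1+q≤) $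
      step-arith refl (add≡ one refl (sym (+-suc (3 * L) (suc q))) (address-< {3} _ (small 2+q≤))) $
      step-load refl 3 refl (small 2+q≤) $
      step-arith refl (sub≡ lo≡ hi≡ (small-5L hi<)) $
      step-arith refl (add≡ L₁ lo≡ refl (address-< {1} _ (small lo<))) $
      step-load refl 1 refl (small lo<) $
      step-arith refl (add≡ L₁ hi≡ refl (address-< {1} _ (small hi<))) $
      step-load refl 1 refl (small hi<) $
      step-arith refl (add≡ L₄ i≡ refl (address-< {4} _ (small (m≤n⇒m≤1+n i<)))) $
      step-load refl 4 refl (small (m≤n⇒m≤1+n i<)) $
      step-arith refl (add≡ L₄ j≡ refl (address-< {4} _ (small (m≤n⇒m≤1+n j<)))) $
      step-load refl 4 refl (small (m≤n⇒m≤1+n j<)) $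
      step-arith refl refl $
      step-arith refl (add≡ one refl (sym (+-suc (4 * L) i)) (address-< {4} _ (small (s≤s i<)))) $
      step-load refl 4 refl (small (s≤s i<)) $
      step-arith refl refl $
      step-store refl 4 refl (small (s≤s i<)) refl $
      step-arith refl (add≡ one refl (sym (+-suc (4 * L) j)) (address-< {4} _ (small (s≤s j<)))) $
      step-load refl 4 refl (small (s≤s j<)) $
      step-arith refl refl $
      step-store refl 4 refl (small (s≤s j<)) refl $
      step-arith refl (add≡ one t≡ refl (small-5L (m≤n⇒m≤1+n (m≤n⇒m≤1+n t<n)))) $
      step-jump refl $
      stop (at (fx , inv , total , refl , r≡ , c≡ , bits , ranks , rows₂))
    where
    q i j : ℕ
    q = σ t
    i = table (suc (rank x q))
    j = table (suc (rank x (suc q)))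
    q<n : q < n
    q<n = σ<n t<n
    1+t≤1+n : suc t ≤ suc n
    1+t≤1+n = m≤n⇒m≤1+n t<n
    1+q≤ : suc q ≤ suc (suc n)
    1+q≤ = m≤n⇒m≤1+n (m≤n⇒m≤1+n q<n)
    2+q≤ : suc (suc q) ≤ suc (suc n)
    2+q≤ = s≤s (m≤n⇒m≤1+n q<n)
    lo≡ : a 3 (suc q) ≡ suc (rank x q)
    lo≡ = ranks _ (<-trans q<n n<h+h)
    hi≡ : a 3 (suc (suc q)) ≡ suc (rank x (suc q))
    hi≡ = ranks _ (≤-<-trans q<n n<h+h)
    lo< : suc (rank x q) ≤ suc (suc n)
    lo< = ≤-trans (s≤s (rank-≤ x q)) 1+q≤
    hi< : suc (rank x (suc q)) ≤ suc (suc n)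
    hi< = ≤-trans (s≤s (rank-≤ x (suc q))) 2+q≤
    i≡ : a 1 (suc (rank x q)) ≡ i
    i≡ = inv _ (small lo<)
    j≡ : a 1 (suc (rank x (suc q))) ≡ j
    j≡ = inv _ (small hi<)
    i≤k : i ≤ k
    i≤k = inverseTable-≤ π k _
    j≤k : j ≤ k
    j≤k = inverseTable-≤ π k _
    i< : i ≤ suc n
    i< = ≤-trans i≤k (m≤n⇒m≤1+n k≤n)
    j< : j ≤ suc n
    j< = ≤-trans j≤k (m≤n⇒m≤1+n k≤n)
    d : ℕ
    d = digit ⌊ q /2⌋ x
    rows₁ : ∀ s → s ≤ suc k → (a 4 [ suc i ≔ evalArith add (a 4 (suc i)) (a 4 i) ]) s
                               ≋ (row x t [ suc i ≔ row x t (suc i) + row x t i ]) s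
    rows₁ = ≋-update rows (≋-add (rows _ (s≤s i≤k)) (rows _ (m≤n⇒m≤1+n i≤k)))
    rows₂ : ∀ s → s ≤ suc k → ((a 4 [ suc i ≔ evalArith add (a 4 (suc i)) (a 4 i) ]) [ suc j ≔
              evalArith add ((a 4 [ suc i ≔ evalArith add (a 4 (suc i)) (a 4 i) ]) (suc j)) (evalArith mul (a 4 j) d) ]) s
              ≋ row x (suc t) s
    rows₂ = ≋-update rows₁ (≋-add (rows₁ _ (s≤s j≤k)) (≋-mul (rows _ (m≤n⇒m≤1+n j≤k)) refl))

  tally : ∀ x {c} → At 76 (Rows x n) c → c ⇝[ 5 ] At 21 (Masks (suc x))
  tally x (at {R} {a} (fx@((_ , _ , _ , _ , _ , k+1) , (_ , _ , L₄ , _ , _) , _) , inv , total , _ , r≡ , c≡ , bits , _ , rows)) =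
    branch _ refl
    where
    k+1≤ : suc k ≤ suc (suc n)
    k+1≤ = s≤s (m≤n⇒m≤1+n k≤n)
    total≡ : ∀ b → (suc k <ᵇ suc (rank x (h + h))) ≡ b →
      Σ< (suc x) count ≡ Σ< x count + (if b then 0 else row x n (suc k))
    total≡ b eq = cong (λ b → Σ< x count + (if b then 0 else row x n (suc k))) eq
    branch : ∀ b → (suc k <ᵇ suc (rank x (h + h))) ≡ b → ⟪ 76 , R , a ⟫ ⇝[ 5 ] At 21 (Masks (suc x))
    branch true skip =
      step-jlt refl (trans (cong₂ _<ᵇ_ k+1 r≡) skip) $
      step-jump refl $
      stop (at (fx , inv , trans total (cong (_mod2^ W) (sym (trans (total≡ true skip) (+-identityʳ _)))) , bits , c≡))
    branch false keep =
      step-jlt refl (trans (cong₂ _<ᵇ_ k+1 r≡) keep) $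
      step-arith refl (add≡ L₄ k+1 refl (address-< {4} _ (small k+1≤))) $
      step-load refl 4 refl (small k+1≤) $
      step-arith refl refl $
      step-jump refl $
      stop (at (fx , inv , trans (≋-add total (rows _ ≤-refl)) (cong (_mod2^ W) (sym (total≡ false keep))) , bits , c≡))

  first-row : ∀ x {c} → At 25 (Scan x h) c → halves h x ≡ 0 → c ⇝[ 4 ] At 49 (Rows x 0)
  first-row x (at {R} {a} (fx@((_ , _ , _ , one , _ , _) , (_ , _ , L₄ , h≡ , _) , _) , inv , total , b≡ , r≡ , _ , carry ,
      low , _ , ranks , zeros)) x<2^h =
      step-jeq refl (trans (cong₂ _≡ᵇ_ b≡ h≡) (≡ᵇ-refl h)) $
      step-arith refl (add≡ L₄ one refl (address-< {4} _ 1<L)) $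
      step-store refl 4 refl 1<L one $
      step-const refl $
      stop (at (fx , inv , total , refl , r≡ , trans (cong (_+ R 13) (sym x<2^h)) carry , low , ranks , rows))
    where
    1<L : 1 < L
    1<L = small (s≤s z≤n)
    rows : ∀ s → s ≤ suc k → (a 4 [ 1 ≔ 1 ]) s ≋ row x 0 s
    rows = ≋-update {g = a 4} {r = λ _ → 0}
      -- The scan has cleared the cells up to `h + h`, and this covers all cells up to `k + 1`
      -- because `k ≤ n < h + h`.
      (λ s s≤ → trans (zeros s (s≤s (≤-trans s≤ (≤-trans (s≤s k≤n) n<h+h)))) (sym (mod2^-small W (<5L⇒<2^W (small-5L z≤n)))))
      (sym (mod2^-small W (<5L⇒<2^W (small-5L (s≤s z≤n)))))

  mask-step : ∀ x {c} → x < 2 ^ h → At 21 (Masks x) c →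
    c ⇝[ 4 + (h * 21 + 4 + n * 27 + 1 + 5) ] At 21 (Masks (suc x))
  mask-step x x<2^h (at {R} {a} (fx@((_ , _ , _ , one , _ , _) , (_ , _ , L₄ , h≡ , nul) , _ , zero≡) , inv , total , bits , c≡)) =
      step-jeq refl (cong₂ _≡ᵇ_ (trans c≡ x≡0) one) $
      step-const refl $
      step-const refl $
      step-const refl $
      ( loop (λ b → At 25 (Scan x b)) h (λ b → scan-step x b)
          (at (fx , inv , total , refl , refl , ≤-refl , +-comm x 1 , (λ _ ()) , (λ b _ → bits b) , (λ _ ()) ,
               -- The scan clears the cells from 1 on. Cell 0 is 0 from the start and stays so,
               -- since every later store into this segment goes to a successor.
               λ { zero _ → zero≡ ; (suc _) (s≤s ()) }))
        then (λ q → first-row x q x≡0)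
        then loop (λ t → At 49 (Rows x t)) n (λ t → row-step x t)
        then rows-done
        then tally x)
    where
    x≡0 : halves h x ≡ 0
    x≡0 = halves-< h x<2^h
    rows-done : ∀ {c} → At 49 (Rows x n) c → c ⇝[ 1 ] At 76 (Rows x n)
    rows-done (at inv@(((n≡ , _) , _) , _ , _ , t≡ , _)) =
      step-jeq refl (trans (cong₂ _≡ᵇ_ t≡ n≡) (≡ᵇ-refl n)) $ stop (at inv)

  Total : (ℕ → ℕ) → Segments → Set
  Total R _ = R 0 ≋ Σ< (2 ^ h) count

  Input : Segments → Set
  Input a = a 0 0 ≡ n × a 0 1 ≡ k
    × (∀ t → t < n → a 0 (2 + t) ≡ suc (σ t))
    × (∀ j → j < k → a 0 (n + (2 + j)) ≡ suc (π j))
    × (∀ u v → 0 < u → v < L → a u v ≡ 0)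

  initialise : ∀ {a} → Input a → ⟪ 0 , (λ _ → 0) , a ⟫ ⇝[ 13 ] At 13 (Setup 0)
  initialise {a} (n≡ , k≡ , σ≡ , π≡ , blank) =
      step-const refl $
      step-const refl $
      step-load refl 0 refl (small z≤n) $
      step-load refl 0 refl (small (s≤s z≤n)) $
      step-jlt refl (trans (cong₂ _<ᵇ_ n≡ k≡) (≮⇒<ᵇ-false (≤⇒≯ k≤n))) $
      step-arith refl (add≡ n≡ refl (+-comm n 1) (small-5L (n≤1+n (suc n)))) $
      step-arith refl (trans (cong (_mod2^ W) L≡′) (mod2^-small W (<5L⇒<2^W (≤L⇒<5L (≤-reflexive (+-identityʳ L)))))) $
      step-arith refl (add≡ k≡ refl (+-comm k 1) (small-5L (≤-trans (s≤s k≤n) (n≤1+n (suc n))))) $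
      step-arith refl (add≡ {x′ = 1 * L} {1 * L} refl refl (sym (*-distribʳ-+ L 1 1)) (multiple< 2)) $
      step-arith refl (add≡ {x′ = 1 * L} {2 * L} refl refl (sym (*-distribʳ-+ L 1 2)) (multiple< 3)) $
      step-arith refl (add≡ {x′ = 2 * L} {2 * L} refl refl (sym (*-distribʳ-+ L 2 2)) (multiple< 4)) $
      step-arith refl (cong (_/ 2) n≡) $
      step-arith refl (add≡ {x′ = 1} {n / 2} refl refl h≡ (small-5L h≤)) $
      stop (at (((n≡ , k≡ , refl , refl , refl , refl) , (refl , refl , refl , refl , refl) , σ≡ , blank 4 0 (s≤s z≤n) 0<L) ,
        refl , refl , refl , π≡ , (λ v → blank 1 v (s≤s z≤n)) , λ b b<h → blank 2 b (s≤s z≤n) (small (≤-trans (<⇒≤ b<h) h≤))))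
    where
    0<L : 0 < L
    0<L = small z≤n
    L≡′ : suc n * 2 ≡ 1 * L
    L≡′ = trans L≡ (sym (+-identityʳ L))
    multiple< : ∀ u {u<5 : T (u <ᵇ 5)} → u * L < 5 * L
    multiple< u {u<5} = subst (_< 5 * L) (+-identityʳ (u * L)) (address-< {u} u<5 0<L)

  run : ∀ {a} → Input a →
    ⟪ 0 , (λ _ → 0) , a ⟫ ⇝[ 13 + k * 8 + 1 + 2 ^ h * (4 + (h * 21 + 4 + n * 27 + 1 + 5)) + 1 ] At 81 Total
  run input =
      initialise input
        then loop (λ i → At 13 (Setup i)) k setup-step
        then setup-done
        then loop (λ x → At 21 (Masks x)) (2 ^ h) mask-step
        then masks-done
    where
    setup-done : ∀ {c} → At 13 (Setup k) c → c ⇝[ 1 ] At 21 (Masks 0)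
    setup-done (at (fx@((_ , k≡ , _) , _) , zero≡ , i≡ , c≡ , _ , table≡ , bits)) =
      step-jeq refl (trans (cong₂ _≡ᵇ_ i≡ k≡) (≡ᵇ-refl k)) $
      stop (at (fx , table≡ , trans zero≡ (sym (mod2^-small W (<5L⇒<2^W (small-5L z≤n)))) ,
        (λ b b<h → trans (bits b b<h) (sym (cong (_% 2) (halves-< b (m^n>0 2 b))))) ,
        trans c≡ (sym (halves-< h (m^n>0 2 h)))))
    masks-done : ∀ {c} → At 21 (Masks (2 ^ h)) c → c ⇝[ 1 ] At 81 Total
    masks-done (at (((_ , _ , _ , one , _) , _) , _ , total , _ , c≡)) =
      step-jeq refl (cong₂ _≡ᵇ_ (trans c≡ (halves-2^ h)) one) $ stop (at total)

-- Sets of blocks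

fromDigits : (ℕ → ℕ) → ℕ → ℕ
fromDigits d zero    = 0
fromDigits d (suc h) = d 0 + fromDigits (d ∘ suc) h * 2

module _ {d : ℕ → ℕ} (d≤1 : d 0 ≤ 1) where
  fromDigits-%2 : ∀ y → (d 0 + y * 2) % 2 ≡ d 0
  fromDigits-%2 y = trans ([m+kn]%n≡m%n (d 0) y 2) (m<n⇒m%n≡m (s≤s d≤1))

  fromDigits-/2 : ∀ y → (d 0 + y * 2) / 2 ≡ y
  fromDigits-/2 y = begin
    (d 0 + y * 2) / 2   ≡⟨ +-distrib-/-∣ʳ (d 0) (n∣m*n y) ⟩
    d 0 / 2 + y * 2 / 2 ≡⟨ cong₂ _+_ (m<n⇒m/n≡0 (s≤s d≤1)) (m*n/n≡m y 2) ⟩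
    y                   ∎
    where open ≡-Reasoning

digit-fromDigits : ∀ d → (∀ b → d b ≤ 1) → ∀ h {b} → b < h → digit b (fromDigits d h) ≡ d b
digit-fromDigits d d≤1 (suc h) {zero}  _         = fromDigits-%2 {d} (d≤1 0) (fromDigits (d ∘ suc) h)
digit-fromDigits d d≤1 (suc h) {suc b} (s≤s b<h) = begin
  digit (suc b) (fromDigits d (suc h))   ≡⟨ cong (_% 2) (halves-suc b (fromDigits d (suc h))) ⟩
  digit b (fromDigits d (suc h) / 2)     ≡⟨ cong (digit b) (fromDigits-/2 {d} (d≤1 0) _) ⟩
  digit b (fromDigits (d ∘ suc) h)       ≡⟨ digit-fromDigits (d ∘ suc) (d≤1 ∘ suc) h b<h ⟩
  d (suc b)                              ∎
  where open ≡-Reasoning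

fromDigits-< : ∀ d → (∀ b → d b ≤ 1) → ∀ h → fromDigits d h < 2 ^ h
fromDigits-< d d≤1 zero    = s≤s z≤n
fromDigits-< d d≤1 (suc h) = begin
  suc (d 0) + fromDigits (d ∘ suc) h * 2 ≤⟨ +-monoˡ-≤ _ (s≤s (d≤1 0)) ⟩
  suc (fromDigits (d ∘ suc) h) * 2       ≤⟨ *-monoˡ-≤ 2 (fromDigits-< (d ∘ suc) (d≤1 ∘ suc) h) ⟩
  2 ^ h * 2                              ≡⟨ *-comm (2 ^ h) 2 ⟩
  2 ^ suc h                              ∎
  where open ≤-Reasoning

digits-injective : ∀ h {x y} → x < 2 ^ h → y < 2 ^ h → (∀ b → b < h → digit b x ≡ digit b y) → x ≡ y
digits-injective zero    (s≤s z≤n) (s≤s z≤n) _ = refl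
digits-injective (suc h) {x} {y} x< y< same = begin
  x                   ≡⟨ m≡m%n+[m/n]*n x 2 ⟩
  x % 2 + x / 2 * 2   ≡⟨ cong₂ (λ r q → r + q * 2) (same 0 (s≤s z≤n))
                          (digits-injective h (half x<) (half y<) same-halves) ⟩
  y % 2 + y / 2 * 2   ≡⟨ m≡m%n+[m/n]*n y 2 ⟨
  y                   ∎
  where
  open ≡-Reasoning
  half : ∀ {z} → z < 2 ^ suc h → z / 2 < 2 ^ h
  half {z} z< = m<n*o⇒m/o<n (subst (z <_) (*-comm 2 (2 ^ h)) z<)
  same-halves : ∀ b → b < h → digit b (x / 2) ≡ digit b (y / 2)
  same-halves b b<h = trans (cong (_% 2) (sym (halves-suc b x)))
    (trans (same (suc b) (s≤s b<h)) (cong (_% 2) (halves-suc b y)))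

weight : ℕ → ℕ → ℕ
weight x b = Σ< b (λ c → digit c x)

-- `rank x p` counts the numbers below `p` that lie in blocks of `x`: the first summand counts the
-- odd ones, the second the even ones.
rank≡weights : ∀ x p → rank x p ≡ weight x ⌊ p /2⌋ + weight x ⌈ p /2⌉
rank≡weights x zero    = refl
rank≡weights x (suc p) = begin
  rank x p + digit ⌊ p /2⌋ x                                ≡⟨ cong (_+ digit ⌊ p /2⌋ x) (trans (rank≡weights x p) (+-comm (weight x ⌊ p /2⌋) _)) ⟩
  weight x ⌈ p /2⌉ + weight x ⌊ p /2⌋ + digit ⌊ p /2⌋ x     ≡⟨ +-assoc (weight x ⌈ p /2⌉) _ _ ⟩
  weight x ⌈ p /2⌉ + weight x (suc ⌊ p /2⌋)                 ∎
  where open ≡-Reasoning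

rank-double : ∀ x b → rank x (b + b) ≡ weight x b + weight x b
rank-double x b = trans (rank≡weights x (b + b))
  (cong₂ (λ l r → weight x l + weight x r) (sym (n≡⌊n+n/2⌋ b)) (sym (n≡⌈n+n/2⌉ b)))

rank-mono : ∀ x {p q} → p ≤ q → rank x p ≤ rank x q
rank-mono x {p} p≤q = go (≤⇒≤′ p≤q)
  where
  go : ∀ {q} → p ≤′ q → rank x p ≤ rank x q
  go ≤′-refl     = ≤-refl
  go (≤′-step l) = ≤-trans (go l) (m≤m+n _ _)

⌊n/2⌋+⌊n/2⌋≤n : ∀ n → ⌊ n /2⌋ + ⌊ n /2⌋ ≤ n
⌊n/2⌋+⌊n/2⌋≤n n = ≤-trans (+-monoʳ-≤ ⌊ n /2⌋ (⌊n/2⌋≤⌈n/2⌉ n)) (≤-reflexive (⌊n/2⌋+⌈n/2⌉≡n n))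

n≤⌈n/2⌉+⌈n/2⌉ : ∀ n → n ≤ ⌈ n /2⌉ + ⌈ n /2⌉
n≤⌈n/2⌉+⌈n/2⌉ n = ≤-trans (≤-reflexive (sym (⌊n/2⌋+⌈n/2⌉≡n n))) (+-monoˡ-≤ ⌈ n /2⌉ (⌊n/2⌋≤⌈n/2⌉ n))

StrictlyIncreasing : ℕ → (ℕ → ℕ) → Set
StrictlyIncreasing k u = ∀ i j → i < j → j < k → u i < u j

module Fitting (h k : ℕ) where

  -- The first component bounds twice the number of blocks by `k`. It settles the blocks above the
  -- last value of `u`, about which the inequalities are silent.
  Fits : ℕ → (ℕ → ℕ) → Set
  Fits x u = rank x (h + h) ≤ k × (∀ a → a < k → rank x (u a) ≤ a × a ≤ rank x (suc (u a)))

  -- The ranges allowed for `u i` and `u j` overlap in at most one value. Equality remains possible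
  -- at this point, as one value of σ may be allowed for two values of π; it is excluded in
  -- `fits⇒increasing`.
  Fits⇒mono : ∀ {x u} → Fits x u → ∀ {i j} → i < j → j < k → u i ≤ u j
  Fits⇒mono {x} {u} (_ , fit) {i} {j} i<j j<k = ≮⇒≥ λ uj<ui → <⇒≱ i<j (begin
    j                ≤⟨ fit j j<k .proj₂ ⟩
    rank x (suc (u j)) ≤⟨ rank-mono x uj<ui ⟩
    rank x (u i)     ≤⟨ fit i (<-trans i<j j<k) .proj₁ ⟩
    i                ∎)
    where open ≤-Reasoning

  module _ (u : ℕ → ℕ) (u-inc : StrictlyIncreasing k u) where

    next? : ∀ c p → Dec (c < k × u c ≡ p)
    next? c p = (c <? k) ×-dec (u c ≟ p)

    advance : ∀ {c p} → Dec (c < k × u c ≡ p) → ℕ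
    advance {c} (yes _) = suc c
    advance {c} (no  _) = c

    -- The number of indices with value below `p`. Since `u` is strictly increasing, these indices
    -- form an initial segment, and it suffices to watch for the next one.
    below : ℕ → ℕ
    below zero    = 0
    below (suc p) = advance (next? (below p) p)

    Splits : ℕ → ℕ → Set
    Splits c p = c ≤ k × (∀ i → i < c → u i < p) × (∀ i → c ≤ i → i < k → p ≤ u i)

    advance-splits : ∀ {c p} (next : Dec (c < k × u c ≡ p)) → Splits c p → Splits (advance next) (suc p)
    advance-splits {c} {p} (yes (c<k , uc≡p)) (c≤k , lt , ge) =
        c<k
      , (λ i i<1+c → at-most i (m≤n⇒m<n∨m≡n (≤-pred i<1+c)))
      , (λ i c<i i<k → subst (_< u i) uc≡p (u-inc _ i c<i i<k))
      where
      at-most : ∀ i → i < c ⊎ i ≡ c → u i < suc p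
      at-most i (inj₁ i<c)  = m≤n⇒m≤1+n (lt i i<c)
      at-most i (inj₂ refl) = s≤s (≤-reflexive uc≡p)
    advance-splits {c} {p} (no ¬next) (c≤k , lt , ge) =
        c≤k
      , (λ i i<c → m≤n⇒m≤1+n (lt i i<c))
      , (λ i c≤i i<k → at-least i i<k (m≤n⇒m<n∨m≡n c≤i))
      where
      at-least : ∀ i → i < k → c < i ⊎ c ≡ i → p < u i
      at-least i i<k (inj₁ c<i)  = ≤-<-trans (ge c ≤-refl (<-trans c<i i<k)) (u-inc _ i c<i i<k)
      at-least i i<k (inj₂ refl) = ≤∧≢⇒< (ge i ≤-refl i<k) λ p≡ → ¬next (i<k , sym p≡)

    below-spec : ∀ p → Splits (below p) p
    below-spec zero    = z≤n , (λ _ ()) , (λ _ _ _ → z≤n)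
    below-spec (suc p) = advance-splits (next? (below p) p) (below-spec p)

    advance-step : ∀ {c p} (next : Dec (c < k × u c ≡ p)) → c ≤ advance next × advance next ≤ suc c
    advance-step (yes _) = n≤1+n _ , ≤-refl
    advance-step (no  _) = ≤-refl , n≤1+n _

    below-step : ∀ p → below p ≤ below (suc p) × below (suc p) ≤ suc (below p)
    below-step p = advance-step (next? (below p) p)

    below-mono : ∀ {p q} → p ≤ q → below p ≤ below q
    below-mono {p} p≤q = go (≤⇒≤′ p≤q)
      where
      go : ∀ {q} → p ≤′ q → below p ≤ below q
      go ≤′-refl     = ≤-refl
      go (≤′-step l) = ≤-trans (go l) (below-step _ .proj₁)

    below-u : ∀ {a} → a < k → below (u a) ≡ a
    below-u {a} a<k = ≤-antisym
      (≮⇒≥ λ a<c → <-irrefl refl (below-spec (u a) .proj₂ .proj₁ a a<c))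
      (≮⇒≥ λ c<a → <⇒≱ (u-inc _ a c<a a<k) (below-spec (u a) .proj₂ .proj₂ _ ≤-refl (<-trans c<a a<k)))

    below-1+u : ∀ {a} → a < k → below (suc (u a)) ≡ suc a
    below-1+u {a} a<k = trans (advance-yes (next? _ (u a)) (subst (_< k) (sym c≡a) a<k , cong u c≡a)) (cong suc c≡a)
      where
      c≡a : below (u a) ≡ a
      c≡a = below-u a<k
      advance-yes : ∀ {c p} (next : Dec (c < k × u c ≡ p)) → c < k × u c ≡ p → advance next ≡ suc c
      advance-yes (yes _) _ = refl
      advance-yes (no ¬n) n = contradiction n ¬n

    -- The weight that every x fitting u must have below block b.
    pairsBelow : ℕ → ℕ
    pairsBelow b = ⌊ below (b + b) /2⌋

    -- A block has two elements, so `below` grows by at most 2 across it and its half by at most 1.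
    -- Consecutive differences can therefore serve as binary digits.
    pairsBelow-step : ∀ b → pairsBelow b ≤ pairsBelow (suc b) × pairsBelow (suc b) ≤ suc (pairsBelow b)
    pairsBelow-step b =
        ⌊n/2⌋-mono (below-mono (+-mono-≤ (n≤1+n b) (n≤1+n b)))
      , ⌊n/2⌋-mono (subst (λ m → below m ≤ suc (suc (below (b + b)))) (cong suc (sym (+-suc b b)))
          (≤-trans (below-step (suc (b + b)) .proj₂) (s≤s (below-step (b + b) .proj₂))))

    -- Let `c` values lie below `b + b`. The next value is at least `b + b`, whence
    -- `rank x (b + b) ≤ c`; the preceding one is smaller, whence `c ≤ rank x (b + b) + 1`. As this
    -- rank is twice the weight, the weight is `c` halved.
    fits⇒weight : ∀ {x} → Fits x u → ∀ b → b ≤ h → weight x b ≡ pairsBelow b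
    fits⇒weight {x} (all≤k , fit) b b≤h = ≤-antisym
      (begin
        ω                ≡⟨ n≡⌊n+n/2⌋ ω ⟩
        ⌊ ω + ω /2⌋      ≤⟨ ⌊n/2⌋-mono (≤-trans (≤-reflexive (sym (rank-double x b))) lower) ⟩
        pairsBelow b     ∎)
      (begin
        pairsBelow b     ≤⟨ ⌊n/2⌋-mono (≤-trans (upper c refl) (s≤s (≤-reflexive (rank-double x b)))) ⟩
        ⌈ ω + ω /2⌉      ≡⟨ n≡⌈n+n/2⌉ ω ⟨
        ω                ∎)
      where
      open ≤-Reasoning
      ω c : ℕ
      ω = weight x b
      c = below (b + b)
      lower : rank x (b + b) ≤ c
      lower with c <? k
      ... | yes c<k = ≤-trans (rank-mono x (below-spec (b + b) .proj₂ .proj₂ c ≤-refl c<k)) (fit c c<k .proj₁)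
      -- All values lie below `b + b`, so there is no next value and the bound on the number of
      -- blocks takes its place.
      ... | no  c≮k = ≤-trans (rank-mono x (+-mono-≤ b≤h b≤h)) (≤-trans all≤k (≮⇒≥ c≮k))
      upper : ∀ m → m ≡ c → m ≤ suc (rank x (b + b))
      upper zero    _   = z≤n
      upper (suc m) m≡c = s≤s (≤-trans (fit m (subst (_≤ k) (sym m≡c) (below-spec (b + b) .proj₁)) .proj₂)
        (rank-mono x (below-spec (b + b) .proj₂ .proj₁ m (≤-reflexive m≡c))))

    -- Apply `rank≡weights`. At `u a` the two block boundaries are at most `u a` and `u a + 1`, with
    -- at most `a` and `a + 1` values below them; at `u a + 1` they are at least these numbers. Both
    -- estimates end in `⌊ a /2⌋ + ⌈ a /2⌉ = a`.
    weight⇒fits : ∀ {x} → (∀ a → a < k → u a < h + h) →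
      (∀ b → b ≤ h → weight x b ≡ pairsBelow b) → Fits x u
    weight⇒fits {x} u< weight≡ = all≤k , λ a a<k → lower a a<k , upper a a<k
      where
      open ≤-Reasoning
      rank≡ : ∀ {p} → p ≤ h + h → rank x p ≡ pairsBelow ⌊ p /2⌋ + pairsBelow ⌈ p /2⌉
      rank≡ {p} p≤ = trans (rank≡weights x p)
        (cong₂ _+_ (weight≡ _ (≤-trans (⌊n/2⌋≤⌈n/2⌉ p) ⌈p/2⌉≤h)) (weight≡ _ ⌈p/2⌉≤h))
        where
        ⌈p/2⌉≤h : ⌈ p /2⌉ ≤ h
        ⌈p/2⌉≤h = ≤-trans (⌈n/2⌉-mono p≤) (≤-reflexive (sym (n≡⌈n+n/2⌉ h)))
      all≤k : rank x (h + h) ≤ k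
      all≤k = begin
        rank x (h + h)                  ≡⟨ rank-double x h ⟩
        weight x h + weight x h         ≡⟨ cong (λ v → v + v) (weight≡ h ≤-refl) ⟩
        pairsBelow h + pairsBelow h     ≤⟨ ⌊n/2⌋+⌊n/2⌋≤n _ ⟩
        below (h + h)                   ≤⟨ below-spec (h + h) .proj₁ ⟩
        k                               ∎
      lower : ∀ a → a < k → rank x (u a) ≤ a
      lower a a<k = begin
        rank x (u a)                                    ≡⟨ rank≡ (<⇒≤ (u< a a<k)) ⟩
        pairsBelow ⌊ u a /2⌋ + pairsBelow ⌈ u a /2⌉     ≤⟨ +-mono-≤
            (⌊n/2⌋-mono (≤-trans (below-mono (⌊n/2⌋+⌊n/2⌋≤n (u a))) (≤-reflexive (below-u a<k))))
            (⌊n/2⌋-mono (≤-trans (below-mono ⌈ua/2⌉+⌈ua/2⌉≤) (≤-reflexive (below-1+u a<k)))) ⟩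
        ⌊ a /2⌋ + ⌈ a /2⌉                               ≡⟨ ⌊n/2⌋+⌈n/2⌉≡n a ⟩
        a                                               ∎
        where
        ⌈ua/2⌉+⌈ua/2⌉≤ : ⌈ u a /2⌉ + ⌈ u a /2⌉ ≤ suc (u a)
        ⌈ua/2⌉+⌈ua/2⌉≤ = ⌊n/2⌋+⌊n/2⌋≤n (suc (u a))
      upper : ∀ a → a < k → a ≤ rank x (suc (u a))
      upper a a<k = begin
        a                                                       ≡⟨ ⌊n/2⌋+⌈n/2⌉≡n a ⟨
        ⌊ a /2⌋ + ⌈ a /2⌉                                       ≤⟨ +-mono-≤
            (⌊n/2⌋-mono (≤-trans (≤-reflexive (sym (below-u a<k))) (below-mono (n≤⌈n/2⌉+⌈n/2⌉ (u a)))))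
            (⌊n/2⌋-mono (≤-trans (≤-reflexive (sym (below-1+u a<k))) (below-mono (n≤⌈n/2⌉+⌈n/2⌉ (suc (u a)))))) ⟩
        pairsBelow ⌊ suc (u a) /2⌋ + pairsBelow ⌈ suc (u a) /2⌉ ≡⟨ rank≡ (u< a a<k) ⟨
        rank x (suc (u a))                                      ∎

    fitting-unique : ∀ {x y} → x < 2 ^ h → y < 2 ^ h → Fits x u → Fits y u → x ≡ y
    fitting-unique {x} {y} x< y< fx fy = digits-injective h x< y< λ b b<h →
      +-cancelˡ-≡ (weight x b) _ _ (begin
        weight x b + digit b x  ≡⟨ fits⇒weight {x} fx (suc b) b<h ⟩
        pairsBelow (suc b)      ≡⟨ fits⇒weight {y} fy (suc b) b<h ⟨
        weight y b + digit b y  ≡⟨ cong (_+ digit b y) (trans (fits⇒weight {y} fy b (<⇒≤ b<h)) (sym (fits⇒weight {x} fx b (<⇒≤ b<h)))) ⟩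
        weight x b + digit b y  ∎)
      where open ≡-Reasoning

    fitting-exists : (∀ a → a < k → u a < h + h) → ∃[ x ] x < 2 ^ h × Fits x u
    fitting-exists u< = x , fromDigits-< d d≤1 h , weight⇒fits {x} u< weight≡
      where
      d : ℕ → ℕ
      -- Half of a count, rounded down, is the number of odd indices counted; hence this digit is 1
      -- exactly when block `b` contains some `u a` with `a` odd.
      d b = pairsBelow (suc b) ∸ pairsBelow b
      d≤1 : ∀ b → d b ≤ 1
      d≤1 b = m≤n+o⇒m∸n≤o (pairsBelow (suc b)) (pairsBelow b)
        (≤-trans (pairsBelow-step b .proj₂) (≤-reflexive (+-comm 1 (pairsBelow b))))
      x : ℕ
      x = fromDigits d h
      weight≡ : ∀ b → b ≤ h → weight x b ≡ pairsBelow b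
      weight≡ zero    _   = refl
      weight≡ (suc b) b<h = trans (cong₂ _+_ (weight≡ b (<⇒≤ b<h)) (digit-fromDigits d d≤1 h b<h))
        (m+[n∸m]≡n (pairsBelow-step b .proj₁))

-- Partial solutions

inverseTable⇒ : ∀ f i {v j} → inverseTable f i (suc v) ≡ suc j → j < i × f j ≡ v
inverseTable⇒ f (suc i) {v} {j} eq with v ≟ f i
... | yes refl with refl ← suc-injective (trans (sym (updated (inverseTable f i) (suc (f i)) (suc i))) eq) = ≤-refl , refl
... | no  v≢fi with j<i , fj≡v ← inverseTable⇒ f i (trans (sym (unchanged (inverseTable f i) (suc i) (v≢fi ∘ suc-injective))) eq)
  = m≤n⇒m≤1+n j<i , fj≡v

InjectiveBelow : ℕ → (ℕ → ℕ) → Set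
InjectiveBelow k f = ∀ i j → i < k → j < k → f i ≡ f j → i ≡ j

⇒inverseTable : ∀ f i {j} → InjectiveBelow i f → j < i → inverseTable f i (suc (f j)) ≡ suc j
⇒inverseTable f (suc i) {j} inj j<1+i with j ≟ i
... | yes refl = updated (inverseTable f i) (suc (f i)) (suc i)
... | no  j≢i  = trans (unchanged (inverseTable f i) (suc i) (j≢i ∘ inj j i j<1+i ≤-refl ∘ suc-injective))
  (⇒inverseTable f i (λ a b a< b< → inj a b (m≤n⇒m≤1+n a<) (m≤n⇒m≤1+n b<)) (≤∧≢⇒< (≤-pred j<1+i) j≢i))

whenever : {P : Set} → Dec P → ℕ → ℕ
whenever p? v = if does p? then v else 0

whenever-yes : {P : Set} (p? : Dec P) {v : ℕ} → P → whenever p? v ≡ v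
whenever-yes (yes _) _ = refl
whenever-yes (no ¬p) p = contradiction p ¬p

whenever-no : {P : Set} (p? : Dec P) {v : ℕ} → ¬ P → whenever p? v ≡ 0
whenever-no (yes p) ¬p = contradiction p ¬p
whenever-no (no _)  _  = refl

update-+ : ∀ (r : ℕ → ℕ) i (f : ℕ → ℕ) m → (r [ suc i ≔ r (suc i) + f i ]) (suc m) ≡ r (suc m) + whenever (m ≟ i) (f m)
update-+ r i f m with m ≟ i
... | yes refl rewrite ≡ᵇ-refl m = refl
... | no m≢i rewrite ≢⇒≡ᵇ-false m≢i = sym (+-identityʳ _)

-- For `i = j` the second update reads the cell already changed by the first, so both contributions
-- are kept.
addBoth-suc : ∀ r i j d m →
  addBoth r i j d (suc m) ≡ r (suc m) + (whenever (m ≟ i) (r m) + whenever (m ≟ j) (r m * d))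
addBoth-suc r i j d m = begin
  (r₁ [ suc j ≔ r₁ (suc j) + r j * d ]) (suc m)                         ≡⟨ update-+ r₁ j (λ m → r m * d) m ⟩
  r₁ (suc m) + whenever (m ≟ j) (r m * d)                               ≡⟨ cong (_+ whenever (m ≟ j) (r m * d)) (update-+ r i r m) ⟩
  r (suc m) + whenever (m ≟ i) (r m) + whenever (m ≟ j) (r m * d)       ≡⟨ +-assoc (r (suc m)) _ _ ⟩
  r (suc m) + (whenever (m ≟ i) (r m) + whenever (m ≟ j) (r m * d))     ∎
  where
  open ≡-Reasoning
  r₁ : ℕ → ℕ
  r₁ = r [ suc i ≔ r (suc i) + r i ]

module Lists (k : ℕ) (σ π : ℕ → ℕ) (π-inj : InjectiveBelow k π) (x : ℕ) where
  open Table σ (inverseTable π k) x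

  entry : ℕ → ℕ
  entry p = inverseTable π k (suc (rank x p))

  Candidate : ℕ → ℕ → Set
  Candidate t j = rank x (σ t) ≤ π j × π j ≤ rank x (suc (σ t))

  candidate? : ∀ t j → Dec (Candidate t j)
  candidate? t j = (rank x (σ t) ≤? π j) ×-dec (π j ≤? rank x (suc (σ t)))

  keep : {P : Set} → Dec P → List (List ℕ) → List (List ℕ)
  keep (yes _) ls = ls
  keep (no  _) ls = []

  -- The sequences counted by `row`, split by whether position `t` is used. The last position comes
  -- first, so a head `v` in front of `w` represents position `length w` of the pattern.
  lists : ℕ → ℕ → List (List ℕ)
  lists zero    t       = [] ∷ []
  lists (suc j) zero    = []
  lists (suc j) (suc t) = lists (suc j) t ++ keep (candidate? t j) (map (t ∷_) (lists j t))

  row-zero : ∀ t → row t 0 ≡ 0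
  row-zero zero    = refl
  row-zero (suc t) = row-zero t

  -- The two ranks differ by the digit, so `π j` lies between them exactly when it equals one of
  -- them, and the inverse table finds this `j`. For digit 0 the ranks coincide, and the factor
  -- `digit` prevents counting `j` twice.
  candidates : ∀ t {j} r → j < k →
    whenever (suc j ≟ entry (σ t)) r + whenever (suc j ≟ entry (suc (σ t))) (r * digit ⌊ σ t /2⌋ x)
      ≡ whenever (candidate? t j) r
  candidates t {j} r j<k = cases (digit ⌊ σ t /2⌋ x) (digit-≤1 ⌊ σ t /2⌋ x) refl
    where
    lo hi : ℕ
    lo = rank x (σ t)
    hi = rank x (suc (σ t))
    at-entry : ∀ {v u} → π j ≡ v → whenever (suc j ≟ inverseTable π k (suc v)) u ≡ u
    at-entry refl = whenever-yes (suc j ≟ _) (sym (⇒inverseTable π k π-inj j<k))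
    off-entry : ∀ {v u} → π j ≢ v → whenever (suc j ≟ inverseTable π k (suc v)) u ≡ 0
    off-entry πj≢ = whenever-no (suc j ≟ _) (λ eq → πj≢ (inverseTable⇒ π k (sym eq) .proj₂))
    cases : ∀ d → d ≤ 1 → digit ⌊ σ t /2⌋ x ≡ d →
      whenever (suc j ≟ entry (σ t)) r + whenever (suc j ≟ entry (suc (σ t))) (r * digit ⌊ σ t /2⌋ x)
      ≡ whenever (candidate? t j) r
    cases d d≤1 d≡ with π j ≟ lo | π j ≟ hi
    cases d d≤1 d≡ | no ≢lo | no ≢hi = trans (cong₂ _+_ (off-entry ≢lo) (off-entry ≢hi))
      (sym (whenever-no (candidate? t j) λ (lo≤ , ≤hi) →
        <⇒≱ (≤∧≢⇒< lo≤ (≢lo ∘ sym)) (≤-pred (≤-trans (≤∧≢⇒< ≤hi ≢hi)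
          (≤-trans (+-monoʳ-≤ lo (subst (_≤ 1) (sym d≡) d≤1)) (≤-reflexive (+-comm lo 1)))))))
    cases d d≤1 d≡ | no ≢lo | yes ≡hi = trans (cong₂ _+_ (off-entry ≢lo) (at-entry ≡hi))
      (trans (trans (cong (r *_) (d≡1 d d≤1 d≡)) (*-identityʳ r))
        (sym (whenever-yes (candidate? t j) (subst (lo ≤_) (sym ≡hi) (m≤m+n lo _) , ≤-reflexive ≡hi))))
      where
      d≡1 : ∀ d → d ≤ 1 → digit ⌊ σ t /2⌋ x ≡ d → digit ⌊ σ t /2⌋ x ≡ 1
      d≡1 (suc zero) _ eq = eq
      d≡1 (suc (suc _)) (s≤s ()) _
      d≡1 zero _ eq = contradiction (trans ≡hi (trans (cong (lo +_) eq) (+-identityʳ lo))) ≢lo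
    cases d d≤1 d≡ | yes ≡lo | no ≢hi = trans (cong₂ _+_ (at-entry ≡lo) (off-entry ≢hi))
      (trans (+-identityʳ r) (sym (whenever-yes (candidate? t j)
        (≤-reflexive (sym ≡lo) , subst (_≤ hi) (sym ≡lo) (m≤m+n lo _)))))
    cases d d≤1 d≡ | yes ≡lo | yes ≡hi = trans (cong₂ _+_ (at-entry ≡lo) (at-entry ≡hi))
      (trans (trans (cong (r +_) (trans (cong (r *_) d≡0) (*-zeroʳ r))) (+-identityʳ r))
        (sym (whenever-yes (candidate? t j) (≤-reflexive (sym ≡lo) , ≤-reflexive ≡hi))))
      where
      d≡0 : digit ⌊ σ t /2⌋ x ≡ 0
      d≡0 = +-cancelˡ-≡ lo _ 0 (trans (sym ≡hi) (trans ≡lo (sym (+-identityʳ lo))))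

  length-keep : {P : Set} (p? : Dec P) (ls : List (List ℕ)) → length (keep p? ls) ≡ whenever p? (length ls)
  length-keep (yes _) ls = refl
  length-keep (no  _) ls = refl

  row≡length : ∀ t j → j ≤ k → row t (suc j) ≡ length (lists j t)
  row≡length zero    zero    _ = refl
  row≡length zero    (suc j) _ = refl
  -- Only an undefined table entry, which is 0, makes the program add to cell 1, and then it adds a
  -- multiple of cell 0, which is 0.
  row≡length (suc t) zero    _ = begin
    row (suc t) 1                                     ≡⟨ addBoth-suc (row t) i i′ d 0 ⟩
    row t 1 + (whenever (0 ≟ i) (row t 0) + whenever (0 ≟ i′) (row t 0 * d))
                                                      ≡⟨ cong (λ z → row t 1 + (whenever (0 ≟ i) z + whenever (0 ≟ i′) (z * d))) (row-zero t) ⟩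
    row t 1 + (whenever (0 ≟ i) 0 + whenever (0 ≟ i′) 0) ≡⟨ cong (row t 1 +_) (cong₂ _+_ (whenever-0 (0 ≟ i)) (whenever-0 (0 ≟ i′))) ⟩
    row t 1 + 0                                       ≡⟨ +-identityʳ (row t 1) ⟩
    row t 1                                           ≡⟨ row≡length t 0 z≤n ⟩
    1                                                 ∎
    where
    open ≡-Reasoning
    i i′ d : ℕ
    i  = entry (σ t)
    i′ = entry (suc (σ t))
    d  = digit ⌊ σ t /2⌋ x
    whenever-0 : {P : Set} (p? : Dec P) → whenever p? 0 ≡ 0
    whenever-0 (yes _) = refl
    whenever-0 (no _)  = refl
  row≡length (suc t) (suc j) j<k = begin
    row (suc t) (suc (suc j))                         ≡⟨ addBoth-suc (row t) (entry (σ t)) (entry (suc (σ t))) (digit ⌊ σ t /2⌋ x) (suc j) ⟩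
    row t (suc (suc j)) + _                           ≡⟨ cong (row t (suc (suc j)) +_) (candidates t (row t (suc j)) j<k) ⟩
    row t (suc (suc j)) + whenever (candidate? t j) (row t (suc j))
                                                      ≡⟨ cong₂ _+_ (row≡length t (suc j) j<k) (cong (whenever (candidate? t j))
                                                          (trans (row≡length t j (<⇒≤ j<k)) (sym (length-map (t ∷_) (lists j t))))) ⟩
    length (lists (suc j) t) + whenever (candidate? t j) (length (map (t ∷_) (lists j t)))
                                                      ≡⟨ cong (length (lists (suc j) t) +_) (length-keep (candidate? t j) _) ⟨
    length (lists (suc j) t) + length (keep (candidate? t j) (map (t ∷_) (lists j t)))
                                                      ≡⟨ length-++ (lists (suc j) t) ⟨
    length (lists (suc j) (suc t))                    ∎
    where open ≡-Reasoning

  Chain : ℕ → List ℕ → Set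
  Chain t []      = ⊤
  Chain t (v ∷ w) = v < t × Candidate v (length w) × Chain v w

  ∈-keep⁻ : {P : Set} (p? : Dec P) {ls : List (List ℕ)} {w : List ℕ} → w ∈ keep p? ls → P × w ∈ ls
  ∈-keep⁻ (yes p) w∈ = p , w∈

  ∈-keep⁺ : {P : Set} (p? : Dec P) {ls : List (List ℕ)} {w : List ℕ} → P → w ∈ ls → w ∈ keep p? ls
  ∈-keep⁺ (yes _) p w∈ = w∈
  ∈-keep⁺ (no ¬p) p w∈ = contradiction p ¬p

  Chain-weaken : ∀ {t} w → Chain t w → Chain (suc t) w
  Chain-weaken []      _             = tt
  Chain-weaken (v ∷ w) (v<t , chain) = m≤n⇒m≤1+n v<t , chain

  ∈-lists⁻ : ∀ j t {w} → w ∈ lists j t → length w ≡ j × Chain t w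
  ∈-lists⁻ zero    t       (here refl) = refl , tt
  ∈-lists⁻ (suc j) (suc t) {w} w∈ with ∈-++⁻ (lists (suc j) t) w∈
  ... | inj₁ w∈ˡ with len , chain ← ∈-lists⁻ (suc j) t w∈ˡ = len , Chain-weaken w chain
  ... | inj₂ w∈ʳ
    with cand , w∈′ ← ∈-keep⁻ (candidate? t j) w∈ʳ
    with w′ , w′∈ , refl ← ∈-map⁻ (t ∷_) w∈′
    with refl , chain ← ∈-lists⁻ j t w′∈ = refl , ≤-refl , cand , chain

  ∈-lists⁺ : ∀ t w → Chain t w → w ∈ lists (length w) t
  ∈-lists⁺ t       []      _ = here refl
  ∈-lists⁺ (suc t) (v ∷ w) (v<1+t , cand , chain) with m≤n⇒m<n∨m≡n (≤-pred v<1+t)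
  ... | inj₁ v<t  = ∈-++⁺ˡ (∈-lists⁺ t (v ∷ w) (v<t , cand , chain))
  ... | inj₂ refl = ∈-++⁺ʳ (lists (suc (length w)) t)
    (∈-keep⁺ (candidate? t (length w)) cand (∈-map⁺ (t ∷_) (∈-lists⁺ t w chain)))

  keep-unique : {P : Set} (p? : Dec P) {ls : List (List ℕ)} → Unique ls → Unique (keep p? ls)
  keep-unique (yes _) u = u
  keep-unique (no  _) u = []

  lists-unique : ∀ j t → Unique (lists j t)
  lists-unique zero    t       = [] ∷ []
  lists-unique (suc j) zero    = []
  lists-unique (suc j) (suc t) = Unique.++⁺ (lists-unique (suc j) t)
    (keep-unique (candidate? t j) (Unique.map⁺ ∷-injectiveʳ (lists-unique j t))) disjoint
    where
    disjoint : ∀ {w} → ¬ (w ∈ lists (suc j) t × w ∈ keep (candidate? t j) (map (t ∷_) (lists j t)))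
    disjoint (w∈ˡ , w∈ʳ)
      with _ , _ , refl ← ∈-map⁻ (t ∷_) (∈-keep⁻ (candidate? t j) w∈ʳ .proj₂)
      with _ , t<t , _ ← ∈-lists⁻ (suc j) t w∈ˡ = <-irrefl refl t<t

  chain⇒ : ∀ f j {t} → Chain t (applyDownFrom f j) →
    (∀ i → i < j → f i < t × Candidate (f i) i) × (∀ i i′ → i < i′ → i′ < j → f i < f i′)
  chain⇒ f zero    _ = (λ _ ()) , (λ _ _ _ ())
  chain⇒ f (suc j) {t} (fj<t , cand , chain) with below , inc ← chain⇒ f j chain = entries , increasing
    where
    entries : ∀ i → i < suc j → f i < t × Candidate (f i) i
    entries i i<1+j with m≤n⇒m<n∨m≡n (≤-pred i<1+j)
    ... | inj₁ i<j  = <-trans (below i i<j .proj₁) fj<t , below i i<j .proj₂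
    ... | inj₂ refl = fj<t , subst (Candidate (f j)) (length-applyDownFrom f j) cand
    increasing : ∀ i i′ → i < i′ → i′ < suc j → f i < f i′
    increasing i i′ i<i′ i′<1+j with m≤n⇒m<n∨m≡n (≤-pred i′<1+j)
    ... | inj₁ i′<j = inc i i′ i<i′ i′<j
    ... | inj₂ refl = below i i<i′ .proj₁

  ⇒chain : ∀ f j {t} → (∀ i → i < j → f i < t × Candidate (f i) i) → StrictlyIncreasing j f → Chain t (applyDownFrom f j)
  ⇒chain f zero    _ _ = tt
  ⇒chain f (suc j) entries inc =
      entries j ≤-refl .proj₁
    , subst (Candidate (f j)) (sym (length-applyDownFrom f j)) (entries j ≤-refl .proj₂)
    , ⇒chain f j (λ i i<j → inc i j i<j ≤-refl , entries i (m≤n⇒m≤1+n i<j) .proj₂)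
                 (λ i i′ i<i′ i′<j → inc i i′ i<i′ (m≤n⇒m≤1+n i′<j))

-- Enumeration of the solutions

-- Such lists are equal as bags, hence permutations of each other. This is how the solutions found
-- by filtering all maps are compared with those collected over all masks.
unique-length : {A : Set} {xs ys : List A} → Unique xs → Unique ys →
  (∀ {x} → x ∈ xs → x ∈ ys) → (∀ {x} → x ∈ ys → x ∈ xs) → length xs ≡ length ys
unique-length xs! ys! to from = ↭-length (∼bag⇒↭ (unique∧set⇒bag xs! ys! (mk⇔ to from)))

allMaps-unique : ∀ n k → Unique (allMaps n k)
allMaps-unique n zero    = [] ∷ []
allMaps-unique n (suc k) = Unique.cartesianProductWith⁺ _∷_ (λ { refl → refl , refl })
  (Unique.allFin⁺ n) (allMaps-unique n k)

∈-allMaps : ∀ {n k} (v : Vec (Fin n) k) → v ∈ allMaps n k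
∈-allMaps []      = here refl
∈-allMaps (i ∷ v) = ∈-cartesianProductWith⁺ _∷_ (∈-allFin i) (∈-allMaps v)

-- The program and the counting work with natural numbers; outside the domain, 0 is a placeholder.
onℕ : ∀ {a b} → (Fin a → Fin b) → ℕ → ℕ
onℕ {a} f i with i <? a
... | yes i<a = toℕ (f (fromℕ< i<a))
... | no  _   = 0

onℕ-toℕ : ∀ {a b} (f : Fin a → Fin b) i → onℕ f (toℕ i) ≡ toℕ (f i)
onℕ-toℕ {a} f i with toℕ i <? a
... | yes i<a = cong (toℕ ∘ f) (Fin.fromℕ<-toℕ i i<a)
... | no  i≮a = contradiction (Fin.toℕ<n i) i≮a

onℕ-< : ∀ {a b} (f : Fin a → Fin b) {i} → i < a → onℕ f i < b
onℕ-< {a} f {i} i<a with i <? a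
... | yes p   = Fin.toℕ<n (f (fromℕ< p))
... | no  i≮a = contradiction i<a i≮a

fin : ∀ {a i} → i < a → ∃[ j ] i ≡ toℕ {a} j
fin i<a = fromℕ< i<a , sym (Fin.toℕ-fromℕ< i<a)

onℕ-injective : ∀ {a b} {f : Fin a → Fin b} → Injective _≡_ _≡_ f → InjectiveBelow a (onℕ f)
onℕ-injective {f = f} inj i j i<a j<a eq with i , refl ← fin i<a | j , refl ← fin j<a =
  cong toℕ (inj (Fin.toℕ-injective (trans (sym (onℕ-toℕ f i)) (trans eq (onℕ-toℕ f j)))))

onℕ-inverse : ∀ {a b} (f : Fin a → Fin b) (g : Fin b → Fin a) → (∀ i → f (g i) ≡ i) →
  ∀ {i} → i < b → onℕ f (onℕ g i) ≡ i
onℕ-inverse f g fg≡id i<b with i , refl ← fin i<b =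
  trans (cong (onℕ f) (onℕ-toℕ g i)) (trans (onℕ-toℕ f (g i)) (cong toℕ (fg≡id i)))

applyDownFrom-cong : {A : Set} {f g : ℕ → A} → ∀ m → (∀ i → i < m → f i ≡ g i) → applyDownFrom f m ≡ applyDownFrom g m
applyDownFrom-cong zero    _   = refl
applyDownFrom-cong (suc m) f≡g = cong₂ _∷_ (f≡g m ≤-refl) (applyDownFrom-cong m λ i i<m → f≡g i (m≤n⇒m≤1+n i<m))

applyDownFrom-injective : {A : Set} {f g : ℕ → A} → ∀ m → applyDownFrom f m ≡ applyDownFrom g m → ∀ i → i < m → f i ≡ g i
applyDownFrom-injective (suc m) eq i i<1+m with i ≟ m
... | yes refl = ∷-injective eq .proj₁
... | no  i≢m  = applyDownFrom-injective m (∷-injective eq .proj₂) i (≤∧≢⇒< (≤-pred i<1+m) i≢m)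

-- A left inverse of `applyDownFrom`: indices run from the end because sequences are stored with the
-- last position first.
fromEnd : List ℕ → ℕ → ℕ
fromEnd []      _ = 0
fromEnd (v ∷ w)   = fromEnd w [ length w ≔ v ]

applyDownFrom-fromEnd : ∀ w → applyDownFrom (fromEnd w) (length w) ≡ w
applyDownFrom-fromEnd []      = refl
applyDownFrom-fromEnd (v ∷ w) = cong₂ _∷_ (updated (fromEnd w) (length w) v)
  (trans (applyDownFrom-cong (length w) λ i i<l → unchanged (fromEnd w) v (<⇒≢ i<l)) (applyDownFrom-fromEnd w))

length-concat-applyUpTo : {A : Set} (f : ℕ → List A) → ∀ m → length (concat (applyUpTo f m)) ≡ Σ< m (length ∘ f)
length-concat-applyUpTo f zero    = refl
length-concat-applyUpTo f (suc m) = begin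
  length (f 0 ++ concat (applyUpTo (f ∘ suc) m))   ≡⟨ length-++ (f 0) ⟩
  length (f 0) + length (concat (applyUpTo (f ∘ suc) m)) ≡⟨ cong (length (f 0) +_) (length-concat-applyUpTo (f ∘ suc) m) ⟩
  length (f 0) + Σ< m (length ∘ f ∘ suc)           ≡⟨ shift m ⟩
  Σ< (suc m) (length ∘ f)                          ∎
  where
  open ≡-Reasoning
  shift : ∀ m → length (f 0) + Σ< m (length ∘ f ∘ suc) ≡ Σ< (suc m) (length ∘ f)
  shift zero    = +-comm (length (f 0)) 0
  shift (suc m) = trans (sym (+-assoc (length (f 0)) _ _)) (cong (_+ length (f (suc m))) (shift m))

Σ<-cong : ∀ m {f g : ℕ → ℕ} → (∀ x → f x ≡ g x) → Σ< m f ≡ Σ< m g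
Σ<-cong zero    _   = refl
Σ<-cong (suc m) f≡g = cong₂ _+_ (Σ<-cong m f≡g) (f≡g m)

-- By trichotomy. It yields the backward half of each equivalence in `IsSolution` from the forward
-- half.
mono⇒reflects : {A : Set} {α β : A → ℕ} → (∀ {i j} → α i ≡ α j → β i ≡ β j) → (∀ {i j} → α i < α j → β i < β j) →
  ∀ {i j} → β i < β j → α i < α j
mono⇒reflects {α = α} eq mono {i} {j} βi<βj with <-cmp (α i) (α j)
... | tri< αi<αj _ _ = αi<αj
... | tri≈ _ αi≡αj _ = contradiction (eq αi≡αj) (<⇒≢ βi<βj)
... | tri> _ _ αj<αi = contradiction (mono αj<αi) (<⇒≯ βi<βj)

module Solutions {n k : ℕ} (σ′ : Permutation′ n) (π′ : Permutation′ k) (h : ℕ) (n≤h+h : n ≤ h + h) where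

  σ π π⁻¹ : ℕ → ℕ
  σ   = onℕ (σ′ ⟨$⟩ʳ_)
  π   = onℕ (π′ ⟨$⟩ʳ_)
  π⁻¹ = onℕ (π′ ⟨$⟩ˡ_)

  perm-injective : ∀ {m} (ρ : Permutation′ m) → Injective _≡_ _≡_ (ρ ⟨$⟩ʳ_)
  perm-injective ρ eq = trans (sym (inverseˡ ρ)) (trans (cong (ρ ⟨$⟩ˡ_) eq) (inverseˡ ρ))

  σ-inj : InjectiveBelow n σ
  σ-inj = onℕ-injective (perm-injective σ′)

  π-inj : InjectiveBelow k π
  π-inj = onℕ-injective (perm-injective π′)

  ππ⁻¹ : ∀ {a} → a < k → π (π⁻¹ a) ≡ a
  ππ⁻¹ = onℕ-inverse (π′ ⟨$⟩ʳ_) (π′ ⟨$⟩ˡ_) (λ i → inverseʳ π′)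

  π⁻¹π : ∀ {i} → i < k → π⁻¹ (π i) ≡ i
  π⁻¹π = onℕ-inverse (π′ ⟨$⟩ˡ_) (π′ ⟨$⟩ʳ_) (λ i → inverseˡ π′)

  π⁻¹< : ∀ {a} → a < k → π⁻¹ a < k
  π⁻¹< = onℕ-< (π′ ⟨$⟩ˡ_)

  π< : ∀ {a} → a < k → π a < k
  π< = onℕ-< (π′ ⟨$⟩ʳ_)

  valuesOf : (ℕ → ℕ) → ℕ → ℕ
  valuesOf f a = σ (f (π⁻¹ a))

  Solution : (ℕ → ℕ) → Set
  Solution f = (∀ i → i < k → f i < n) × StrictlyIncreasing k f × StrictlyIncreasing k (valuesOf f)

  IsSolution⇒ : ∀ {f} → IsSolution σ′ π′ f → Solution (onℕ f)
  IsSolution⇒ {f} (_ , values , positions) = (λ i → onℕ-< f) , increasing , values-increasing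
    where
    increasing : StrictlyIncreasing k (onℕ f)
    increasing i j i<j j<k with i , refl ← fin (<-trans i<j j<k) | j , refl ← fin j<k =
      subst₂ _<_ (sym (onℕ-toℕ f i)) (sym (onℕ-toℕ f j)) (Equivalence.to (positions i j) i<j)
    value : ∀ a → valuesOf (onℕ f) (toℕ a) ≡ toℕ (σ′ ⟨$⟩ʳ f (π′ ⟨$⟩ˡ a))
    value a = trans (cong (σ ∘ onℕ f) (onℕ-toℕ (π′ ⟨$⟩ˡ_) a))
      (trans (cong σ (onℕ-toℕ f _)) (onℕ-toℕ (σ′ ⟨$⟩ʳ_) _))
    values-increasing : StrictlyIncreasing k (valuesOf (onℕ f))
    values-increasing a b a<b b<k with a , refl ← fin (<-trans a<b b<k) | b , refl ← fin b<k =
      subst₂ _<_ (sym (value a)) (sym (value b))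
        (Equivalence.to (values _ _) (subst₂ _<_ (cong toℕ (sym (inverseʳ π′))) (cong toℕ (sym (inverseʳ π′))) a<b))

  ⇒IsSolution : ∀ {f} → Solution (onℕ f) → IsSolution σ′ π′ f
  ⇒IsSolution {f} (_ , increasing , values-increasing) =
      (λ {i} {j} eq → Fin.toℕ-injective (f-reflects-≡ i j (cong toℕ eq)))
    , (λ i j → mk⇔ (values i j) (mono⇒reflects {α = λ i → toℕ (π′ ⟨$⟩ʳ i)} {β = λ i → toℕ (σ′ ⟨$⟩ʳ f i)}
                                  (λ eq → cong (λ i → toℕ (σ′ ⟨$⟩ʳ f i)) (perm-injective π′ (Fin.toℕ-injective eq)))
                                  (values _ _)))
    , (λ i j → mk⇔ (positions i j) (mono⇒reflects {α = toℕ} {β = toℕ ∘ f}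
                                  (λ eq → cong (toℕ ∘ f) (Fin.toℕ-injective eq)) (positions _ _)))
    where
    positions : ∀ i j → toℕ i < toℕ j → toℕ (f i) < toℕ (f j)
    positions i j i<j = subst₂ _<_ (onℕ-toℕ f i) (onℕ-toℕ f j) (increasing _ _ i<j (Fin.toℕ<n j))
    f-reflects-≡ : ∀ i j → toℕ (f i) ≡ toℕ (f j) → toℕ i ≡ toℕ j
    f-reflects-≡ i j eq with <-cmp (toℕ i) (toℕ j)
    ... | tri< i<j _ _ = contradiction eq (<⇒≢ (positions i j i<j))
    ... | tri≈ _ i≡j _ = i≡j
    ... | tri> _ _ j<i = contradiction (sym eq) (<⇒≢ (positions j i j<i))
    value : ∀ i → valuesOf (onℕ f) (toℕ (π′ ⟨$⟩ʳ i)) ≡ toℕ (σ′ ⟨$⟩ʳ f i)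
    value i = trans (cong (σ ∘ onℕ f) (trans (onℕ-toℕ (π′ ⟨$⟩ˡ_) _) (cong toℕ (inverseˡ π′))))
      (trans (cong σ (onℕ-toℕ f i)) (onℕ-toℕ (σ′ ⟨$⟩ʳ_) _))
    values : ∀ i j → toℕ (π′ ⟨$⟩ʳ i) < toℕ (π′ ⟨$⟩ʳ j) → toℕ (σ′ ⟨$⟩ʳ f i) < toℕ (σ′ ⟨$⟩ʳ f j)
    values i j lt = subst₂ _<_ (value i) (value j) (values-increasing _ _ lt (Fin.toℕ<n _))

  open Fitting h k
  open Lists k σ π π-inj
  open Table σ (inverseTable π k)

  -- `Fits⇒mono` gives weak monotonicity. Equal values are impossible because σ, `f` and the inverse
  -- of π are injective.
  fits⇒increasing : ∀ {x f} → (∀ i → i < k → f i < n) → StrictlyIncreasing k f → Fits x (valuesOf f) →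
    StrictlyIncreasing k (valuesOf f)
  fits⇒increasing {x} {f} f< inc fits a b a<b b<k = ≤∧≢⇒< (Fits⇒mono {x} fits a<b b<k) λ eq →
    <⇒≢ a<b (trans (sym (ππ⁻¹ a<k)) (trans (cong π (f-inj (σ-inj _ _ (f< _ (π⁻¹< a<k)) (f< _ (π⁻¹< b<k)) eq))) (ππ⁻¹ b<k)))
    where
    a<k : a < k
    a<k = <-trans a<b b<k
    f-inj : f (π⁻¹ a) ≡ f (π⁻¹ b) → π⁻¹ a ≡ π⁻¹ b
    f-inj eq with <-cmp (π⁻¹ a) (π⁻¹ b)
    ... | tri< lt _ _ = contradiction eq (<⇒≢ (inc _ _ lt (π⁻¹< b<k)))
    ... | tri≈ _ e _  = e
    ... | tri> _ _ gt = contradiction (sym eq) (<⇒≢ (inc _ _ gt (π⁻¹< a<k)))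

  solutionsFitting : ℕ → List (List ℕ)
  solutionsFitting x = if suc k <ᵇ suc (rank x (h + h)) then [] else lists x k n

  length-solutionsFitting : ∀ x → length (solutionsFitting x) ≡ fittings# x n k h
  length-solutionsFitting x with k <ᵇ rank x (h + h)
  ... | true  = refl
  ... | false = sym (row≡length x n k ≤-refl)

  ∈-unless : ∀ b {ls : List (List ℕ)} {w : List ℕ} → w ∈ (if b then [] else ls) → b ≡ false × w ∈ ls
  ∈-unless false w∈ = refl , w∈

  FittingSolution : ℕ → (ℕ → ℕ) → Set
  FittingSolution x f = (∀ i → i < k → f i < n) × StrictlyIncreasing k f × Fits x (valuesOf f)

  ∈-solutionsFitting⁻ : ∀ x {w} → w ∈ solutionsFitting x → ∃[ f ] w ≡ applyDownFrom f k × FittingSolution x f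
  ∈-solutionsFitting⁻ x {w} w∈ = f , w≡ , (λ i i<k → entries i i<k .proj₁) , inc , rank≤k , fits
    where
    f : ℕ → ℕ
    f = fromEnd w
    b≡false : (suc k <ᵇ suc (rank x (h + h))) ≡ false
    b≡false = ∈-unless _ w∈ .proj₁
    rank≤k : rank x (h + h) ≤ k
    rank≤k = ≮⇒≥ λ k<r → contradiction (trans (sym (<⇒<ᵇ-true k<r)) b≡false) λ ()
    w∈lists : w ∈ lists x k n
    w∈lists = ∈-unless (suc k <ᵇ suc (rank x (h + h))) w∈ .proj₂
    w≡ : w ≡ applyDownFrom f k
    w≡ = trans (sym (applyDownFrom-fromEnd w)) (cong (applyDownFrom f) (∈-lists⁻ x k n w∈lists .proj₁))
    chain : _
    chain = chain⇒ x f k (subst (Chain x n) w≡ (∈-lists⁻ x k n w∈lists .proj₂))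
    entries : ∀ i → i < k → f i < n × Candidate x (f i) i
    entries = chain .proj₁
    inc : StrictlyIncreasing k f
    inc = chain .proj₂
    fits : ∀ a → a < k → rank x (valuesOf f a) ≤ a × a ≤ rank x (suc (valuesOf f a))
    -- Candidates are indexed by positions of the pattern, fitting by its values; the two meet at
    -- `a = π (π⁻¹ a)`.
    fits a a<k = subst (λ a′ → rank x (valuesOf f a) ≤ a′ × a′ ≤ rank x (suc (valuesOf f a))) (ππ⁻¹ a<k)
      (entries (π⁻¹ a) (π⁻¹< a<k) .proj₂)

  ∈-solutionsFitting⁺ : ∀ x f → FittingSolution x f → applyDownFrom f k ∈ solutionsFitting x
  ∈-solutionsFitting⁺ x f (f< , inc , rank≤k , fits)
    rewrite ≮⇒<ᵇ-false (≤⇒≯ rank≤k) = subst (λ j → applyDownFrom f k ∈ lists x j n) (length-applyDownFrom f k)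
      (∈-lists⁺ x n (applyDownFrom f k) (⇒chain x f k (λ i i<k → f< i i<k , candidate i i<k) inc))
    where
    candidate : ∀ i → i < k → Candidate x (f i) i
    candidate i i<k = subst (λ j → rank x (σ (f j)) ≤ π i × π i ≤ rank x (suc (σ (f j)))) (π⁻¹π i<k) (fits (π i) (π< i<k))

  solutionsFitting-unique : ∀ x → Unique (solutionsFitting x)
  solutionsFitting-unique x with k <ᵇ rank x (h + h)
  ... | true  = []
  ... | false = lists-unique x k n

  -- A common member would give one strictly increasing `u` fitted by both masks, contrary to
  -- `fitting-unique`. So no solution is counted twice.
  solutionsFitting-disjoint : ∀ {x y} → x < y → y < 2 ^ h → ∀ {w} → ¬ (w ∈ solutionsFitting x × w ∈ solutionsFitting y)
  solutionsFitting-disjoint {x} {y} x<y y< {w} (w∈x , w∈y)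
    with f , refl , f< , f-inc , fits ← ∈-solutionsFitting⁻ x w∈x
    with g , f≡g , g< , g-inc , rank≤k , fits′ ← ∈-solutionsFitting⁻ y w∈y
    = <⇒≢ x<y (fitting-unique (valuesOf f) (fits⇒increasing {x} f< f-inc fits) {x} {y} (<-trans x<y y<) y< fits
        (rank≤k , λ a a<k → subst (λ q → rank y q ≤ a × a ≤ rank y (suc q)) (sym (values≡ a a<k)) (fits′ a a<k)))
    where
    values≡ : ∀ a → a < k → valuesOf f a ≡ valuesOf g a
    values≡ a a<k = cong σ (applyDownFrom-injective k f≡g (π⁻¹ a) (π⁻¹< a<k))

  encode : Vec (Fin n) k → List ℕ
  encode v = applyDownFrom (onℕ (lookup v)) k

  encode-injective : ∀ {v v′} → encode v ≡ encode v′ → v ≡ v′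
  encode-injective {v} {v′} eq = begin
    v                    ≡⟨ tabulate∘lookup v ⟨
    tabulate (lookup v)  ≡⟨ tabulate-cong (λ i → Fin.toℕ-injective (trans (sym (onℕ-toℕ (lookup v) i))
                              (trans (applyDownFrom-injective k eq (toℕ i) (Fin.toℕ<n i)) (onℕ-toℕ (lookup v′) i)))) ⟩
    tabulate (lookup v′) ≡⟨ tabulate∘lookup v′ ⟩
    v′                   ∎
    where open ≡-Reasoning

  decode : ∀ {f : ℕ → ℕ} → (∀ i → i < k → f i < n) → Σ (Vec (Fin n) k) λ v → ∀ i → i < k → onℕ (lookup v) i ≡ f i
  decode {f} f< = tabulate g , agrees
    where
    g : Fin k → Fin n
    g i = fromℕ< (f< (toℕ i) (Fin.toℕ<n i))
    agrees : ∀ i → i < k → onℕ (lookup (tabulate g)) i ≡ f i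
    agrees i i<k with i , refl ← fin i<k =
      trans (onℕ-toℕ (lookup (tabulate g)) i) (trans (cong toℕ (lookup∘tabulate g i)) (Fin.toℕ-fromℕ< (f< (toℕ i) (Fin.toℕ<n i))))

  Solution-cong : ∀ {f g} → (∀ i → i < k → f i ≡ g i) → Solution f → Solution g
  Solution-cong f≡g (f< , inc , values-inc) =
      (λ i i<k → subst (_< n) (f≡g i i<k) (f< i i<k))
    , (λ i j i<j j<k → subst₂ _<_ (f≡g i (<-trans i<j j<k)) (f≡g j j<k) (inc i j i<j j<k))
    , (λ a b a<b b<k → subst₂ _<_ (cong σ (f≡g _ (π⁻¹< (<-trans a<b b<k)))) (cong σ (f≡g _ (π⁻¹< b<k)))
                         (values-inc a b a<b b<k))

  fittings : List (List ℕ)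
  fittings = concat (applyUpTo solutionsFitting (2 ^ h))

  fittings-unique : Unique fittings
  fittings-unique = Unique.concat⁺ (All.applyUpTo⁺₂ solutionsFitting (2 ^ h) solutionsFitting-unique)
    (AllPairs.applyUpTo⁺₁ solutionsFitting (2 ^ h) solutionsFitting-disjoint)

  -- The mask is supplied by `fitting-exists`, as all values of σ are below `n ≤ h + h` and thus lie
  -- in the first `h` blocks.
  ∈-fittings⁺ : ∀ {f} → Solution f → applyDownFrom f k ∈ fittings
  ∈-fittings⁺ {f} (f< , inc , values-inc) = found (fitting-exists (valuesOf f) values-inc
      (λ a a<k → <-≤-trans (onℕ-< (σ′ ⟨$⟩ʳ_) (f< _ (π⁻¹< a<k))) n≤h+h))
    where
    found : (∃[ x ] x < 2 ^ h × Fits x (valuesOf f)) → applyDownFrom f k ∈ fittings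
    found (x , x< , fits) = ∈-concat⁺′ (∈-solutionsFitting⁺ x f (f< , inc , fits)) (∈-applyUpTo⁺ solutionsFitting x<)

  ∈-fittings⁻ : ∀ {w} → w ∈ fittings → Σ (Vec (Fin n) k) λ v → IsSolution σ′ π′ (lookup v) × w ≡ encode v
  ∈-fittings⁻ w∈
    with _ , w∈x , x∈ ← ∈-concat⁻′ (applyUpTo solutionsFitting (2 ^ h)) w∈
    with x , _ , refl ← ∈-applyUpTo⁻ solutionsFitting x∈
    with f , w≡ , f< , inc , fits ← ∈-solutionsFitting⁻ x w∈x
    with v , v≡f ← decode f<
    = v
    , ⇒IsSolution (Solution-cong (λ i i<k → sym (v≡f i i<k)) (f< , inc , fits⇒increasing {x} f< inc fits))
    , trans w≡ (applyDownFrom-cong k λ i i<k → sym (v≡f i i<k))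

  solution? : ∀ v → Dec (IsSolution σ′ π′ (lookup v))
  solution? v = isSolution? σ′ π′ (lookup v)

  solutions : List (Vec (Fin n) k)
  solutions = filter solution? (allMaps n k)

  encodings⇒fittings : ∀ {w} → w ∈ map encode solutions → w ∈ fittings
  encodings⇒fittings w∈ = found (∈-map⁻ encode w∈)
    where
    found : ∀ {w} → (∃[ v ] v ∈ solutions × w ≡ encode v) → w ∈ fittings
    found (v , v∈ , refl) = ∈-fittings⁺ (IsSolution⇒ (∈-filter⁻ solution? {xs = allMaps n k} v∈ .proj₂))

  fittings⇒encodings : ∀ {w} → w ∈ fittings → w ∈ map encode solutions
  fittings⇒encodings w∈ = found (∈-fittings⁻ w∈)
    where
    found : ∀ {w} → (Σ (Vec (Fin n) k) λ v → IsSolution σ′ π′ (lookup v) × w ≡ encode v) → w ∈ map encode solutions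
    found (v , sol , refl) = ∈-map⁺ encode (∈-filter⁺ solution? (∈-allMaps v) sol)

  #solutions≡Σ : #solutions σ′ π′ ≡ Σ< (2 ^ h) (λ x → fittings# x n k h)
  #solutions≡Σ = begin
    length solutions                          ≡⟨ length-map encode solutions ⟨
    length (map encode solutions)             ≡⟨ unique-length
        (Unique.map⁺ encode-injective (Unique.filter⁺ solution? (allMaps-unique n k)))
        fittings-unique encodings⇒fittings fittings⇒encodings ⟩
    length fittings                           ≡⟨ length-concat-applyUpTo solutionsFitting (2 ^ h) ⟩
    Σ< (2 ^ h) (length ∘ solutionsFitting)    ≡⟨ Σ<-cong (2 ^ h) length-solutionsFitting ⟩
    Σ< (2 ^ h) (λ x → fittings# x n k h)      ∎
    where open ≡-Reasoning

-- Resource bounds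

!?-++ˡ : {A : Set} (xs {ys} : List A) {i : ℕ} → i < length xs → (xs ++ ys) !? i ≡ xs !? i
!?-++ˡ (x ∷ xs) {i = zero}  _         = refl
!?-++ˡ (x ∷ xs) {i = suc i} (s≤s i<l) = !?-++ˡ xs i<l

!?-++ʳ : {A : Set} (xs {ys} : List A) (i : ℕ) → (xs ++ ys) !? (length xs + i) ≡ ys !? i
!?-++ʳ []       i = refl
!?-++ʳ (x ∷ xs) i = !?-++ʳ xs i

!?-beyond : {A : Set} (xs : List A) {i : ℕ} → length xs ≤ i → xs !? i ≡ nothing
!?-beyond []       {zero}  _         = refl
!?-beyond []       {suc i} _         = refl
!?-beyond (x ∷ xs) {suc i} (s≤s l≤i) = !?-beyond xs l≤i

!?-tabulate : {A : Set} {m : ℕ} (f : Fin m → A) (i : Fin m) → List.tabulate f !? toℕ i ≡ just (f i)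
!?-tabulate f Fin.zero    = refl
!?-tabulate f (Fin.suc i) = !?-tabulate (f ∘ Fin.suc) i

length-oneLine : ∀ {m} (ρ : Permutation′ m) → length (oneLine ρ) ≡ m
length-oneLine {m} ρ = trans (length-map _ (allFin m)) (length-tabulate id)

oneLine-!? : ∀ {m} (ρ : Permutation′ m) {i} → i < m → oneLine ρ !? i ≡ just (suc (onℕ (ρ ⟨$⟩ʳ_) i))
oneLine-!? ρ i<m with i , refl ← fin i<m =
  trans (cong (_!? toℕ i) (map-tabulate id (λ i → suc (toℕ (ρ ⟨$⟩ʳ i)))))
    (trans (!?-tabulate (λ i → suc (toℕ (ρ ⟨$⟩ʳ i))) i) (cong (just ∘ suc) (sym (onℕ-toℕ (ρ ⟨$⟩ʳ_) i))))

n/2≡⌊n/2⌋ : ∀ n → n / 2 ≡ ⌊ n /2⌋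
n/2≡⌊n/2⌋ zero          = refl
n/2≡⌊n/2⌋ (suc zero)    = refl
n/2≡⌊n/2⌋ (suc (suc n)) = trans (m/n≡1+[m∸n]/n {suc (suc n)} {2} (s≤s (s≤s z≤n))) (cong suc (n/2≡⌊n/2⌋ n))

k>n⇒#solutions≡0 : ∀ {n k} (σ : Permutation′ n) (π : Permutation′ k) → n < k → #solutions σ π ≡ 0
k>n⇒#solutions≡0 {n} {k} σ π n<k = cong length
  (filter-none (λ v → isSolution? σ π (lookup v))
    (universal (λ { v (injective , _) → <⇒≱ n<k (Fin.injective⇒≤ {f = lookup v} injective) }) (allMaps n k)))

module _ {n k : ℕ} (σ : Permutation′ n) (π : Permutation′ k) where
  private
    input : List ℕ
    input = n ∷ k ∷ oneLine σ ++ oneLine π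

  length-input : length input ≡ 2 + (n + k)
  length-input = cong (2 +_) (trans (length-++ (oneLine σ)) (cong₂ _+_ (length-oneLine σ) (length-oneLine π)))

  initial-σ : ∀ {t} → t < n → mem (initial σ π) (2 + t) ≡ suc (onℕ (σ ⟨$⟩ʳ_) t)
  initial-σ t<n = cong (fromMaybe 0)
    (trans (!?-++ˡ (oneLine σ) (subst (_ <_) (sym (length-oneLine σ)) t<n)) (oneLine-!? σ t<n))

  initial-π : ∀ {j} → j < k → mem (initial σ π) (n + (2 + j)) ≡ suc (onℕ (π ⟨$⟩ʳ_) j)
  initial-π {j} j<k = trans
    (cong (mem (initial σ π)) (trans (+-suc n (suc j)) (cong suc (+-suc n j))))
    (cong (fromMaybe 0) (trans (cong (λ m → (oneLine σ ++ oneLine π) !? (m + j)) (sym (length-oneLine σ)))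
      (trans (!?-++ʳ (oneLine σ) j) (oneLine-!? π j<k))))

  initial-blank : ∀ {a} → 2 + (n + k) ≤ a → mem (initial σ π) a ≡ 0
  initial-blank {a} ≤a = cong (fromMaybe 0) (!?-beyond input (subst (_≤ a) (sym length-input) ≤a))

-- Every term is at most a multiple of `n * P`, where `P` stands for `2 ^ ⌊ n /2⌋`; the factors add
-- up to `15 + 8 + 2 * (35 + 21 + 27) = 189`.
steps-≤ : ∀ n k h P → 0 < n → 0 < P → k ≤ n → h ≤ n →
  13 + k * 8 + 1 + 2 * P * (4 + (suc h * 21 + 4 + n * 27 + 1 + 5)) + 1 ≤ 189 * (n * P)
steps-≤ n k h P 0<n 0<P k≤n h≤n = begin
  13 + k * 8 + 1 + 2 * P * (4 + (suc h * 21 + 4 + n * 27 + 1 + 5)) + 1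
    ≡⟨ solve 4 (λ n k h P →
         con 13 :+ k :* con 8 :+ con 1
           :+ con 2 :* P :* (con 4 :+ ((con 1 :+ h) :* con 21 :+ con 4 :+ n :* con 27 :+ con 1 :+ con 5)) :+ con 1
         := con 15 :+ con 8 :* k :+ con 2 :* P :* (con 35 :+ con 21 :* h :+ con 27 :* n)) refl n k h P ⟩
  15 + 8 * k + 2 * P * (35 + 21 * h + 27 * n)
    ≤⟨ +-mono-≤ (+-mono-≤ (*-monoʳ-≤ 15 1≤nP) (*-monoʳ-≤ 8 (≤-trans k≤n n≤nP)))
         (*-monoʳ-≤ (2 * P) (+-monoˡ-≤ (27 * n) (+-mono-≤ (*-monoʳ-≤ 35 0<n) (*-monoʳ-≤ 21 h≤n)))) ⟩
  15 * (n * P) + 8 * (n * P) + 2 * P * (35 * n + 21 * n + 27 * n)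
    ≡⟨ solve 2 (λ n P → con 15 :* (n :* P) :+ con 8 :* (n :* P) :+ con 2 :* P :* (con 35 :* n :+ con 21 :* n :+ con 27 :* n)
         := con 189 :* (n :* P)) refl n P ⟩
  189 * (n * P) ∎
  where
  open ≤-Reasoning
  open +-*-Solver
  n≤nP : n ≤ n * P
  n≤nP = m≤m*n n P {{>-nonZero 0<P}}
  1≤nP : 1 ≤ n * P
  1≤nP = ≤-trans 0<n n≤nP

space-≤ : ∀ n → 0 < n → 5 * (suc n * 2) ≤ 20 * n
space-≤ n 0<n = begin
  5 * (suc n * 2)   ≤⟨ *-monoʳ-≤ 5 (*-monoˡ-≤ 2 (+-monoˡ-≤ n 0<n)) ⟩
  5 * ((n + n) * 2) ≡⟨ solve 1 (λ n → con 5 :* ((n :+ n) :* con 2) := con 20 :* n) refl n ⟩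
  20 * n            ∎
  where open ≤-Reasoning
        open +-*-Solver

module _ {n k : ℕ} (σ : Permutation′ n) (π : Permutation′ k) (w W : ℕ) (0<n : 0 < n) (0<k : 0 < k)
  (20[n+k]≤2^w : 20 * (n + k) ≤ 2 ^ w) (w≤W : w ≤ W) (#<2^W : #solutions σ π < 2 ^ W) where
  open WordRAM w W

  private
    L : ℕ
    L = suc n * 2

    5L≤2^w : 5 * L ≤ 2 ^ w
    -- The five segments have `10 * (n + 1) ≤ 20 * n` cells in all, which is where the word length
    -- constant 20 comes from.
    5L≤2^w = ≤-trans (space-≤ n 0<n) (≤-trans (*-monoʳ-≤ 20 (m≤m+n n k)) 20[n+k]≤2^w)

  open Simulation countSolutions w W L 5L≤2^w w≤W

  start : Config
  start = ⟪ 0 , (λ _ → 0) , (λ u i → mem (initial σ π) (u * L + i)) ⟫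

  Counted : Config → Set
  Counted = At 81 (λ R _ → R 0 ≡ #solutions σ π)

  Success : Set
  Success = ∃[ t ] ∃[ s ] (countSolutions ⊢ initial σ π ⟶⟨ t ⟩ s) × Halted countSolutions s ×
    reg s 0 ≡ #solutions σ π × t ≤ 189 * (n * 2 ^ ⌊ n /2⌋) × space s ≤ 20 * n

  succeed : ∀ {u} → start ⇝[ u ] Counted → u ≤ 189 * (n * 2 ^ ⌊ n /2⌋) → Success
  succeed x u≤ = finish (x .reach {sp = 0} (λ _ _ _ → refl) z≤n)
    where
    finish : _ → Success
    finish (_ , _ , _ , t , run , t≤ , _ , sp≤ , at counted) =
      t , _ , run , refl , counted , ≤-trans t≤ u≤ , ≤-trans sp≤ (space-≤ n 0<n)

  long-pattern : n < k → Success
  long-pattern n<k = succeed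
    ( step-const refl $
      step-const refl $
      step-load refl 0 {0} refl (s≤s z≤n) $
      step-load refl 0 {1} refl (s≤s (s≤s z≤n)) $
      step-jlt refl (<⇒<ᵇ-true n<k) $
      stop {t = 0} (at (sym (k>n⇒#solutions≡0 σ π n<k))))
    (≤-trans (*-mono-≤ {5} {189} (≤ᵇ⇒≤ 5 189 _) (*-mono-≤ 0<n (m^n>0 2 ⌊ n /2⌋))) ≤-refl)

  module _ (k≤n : k ≤ n) where
    private
      h : ℕ
      h = suc ⌊ n /2⌋

    open Correct n k w W L h (onℕ (σ ⟨$⟩ʳ_)) (onℕ (π ⟨$⟩ʳ_)) refl (cong suc (n/2≡⌊n/2⌋ n)) 0<n 0<k k≤n
      (onℕ-< (σ ⟨$⟩ʳ_)) (onℕ-< (π ⟨$⟩ʳ_)) 5L≤2^w w≤W using (n<h+h; Input; run)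
    open Solutions σ π h (<⇒≤ n<h+h) using (#solutions≡Σ)

    blank : ∀ u v → 0 < u → v < L → mem (initial σ π) (u * L + v) ≡ 0
    blank (suc u) v _ _ = initial-blank σ π (begin
      2 + (n + k)       ≤⟨ +-monoʳ-≤ 2 (+-monoʳ-≤ n k≤n) ⟩
      2 + (n + n)       ≡⟨ solve 1 (λ n → con 2 :+ (n :+ n) := (con 1 :+ n) :* con 2) refl n ⟩
      L                 ≤⟨ m≤m+n L (u * L) ⟩
      suc u * L         ≤⟨ m≤m+n (suc u * L) v ⟩
      suc u * L + v     ∎)
      where open ≤-Reasoning
            open +-*-Solver

    input : Input (seg start)
    input = refl , refl , (λ t → initial-σ σ π) , (λ j → initial-π σ π) , blank

    short-pattern : Success
    short-pattern = succeed
      -- Register 0 holds the count modulo `2 ^ W`; as the number of solutions is below `2 ^ W`, the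
      -- residue is the number itself.
      (run input then λ { (at total) → stop {t = 0} (at (trans total
        (trans (cong (_mod2^ W) (sym #solutions≡Σ)) (mod2^-small W #<2^W)))) })
      (≤-trans (≤-reflexive (+-identityʳ _))
        (steps-≤ n k ⌊ n /2⌋ (2 ^ ⌊ n /2⌋) 0<n (m^n>0 2 ⌊ n /2⌋) k≤n (⌊n/2⌋≤n n)))

countSolutions-correct : CountsSolutionsWithin (λ n → 189 * (n * 2 ^ ⌊ n /2⌋)) (λ n → 20 * n) countSolutions 20
countSolutions-correct n k σ π w W 20[n+k]≤2^w w≤W #<2^W with k ≤? n
... | yes k≤n = short-pattern σ π w W (>-nonZero⁻¹ n) (>-nonZero⁻¹ k) 20[n+k]≤2^w w≤W #<2^W k≤n
... | no  k≰n = long-pattern σ π w W (>-nonZero⁻¹ n) (>-nonZero⁻¹ k) 20[n+k]≤2^w w≤W #<2^W (≰⇒> k≰n)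

-- Comparison with the powers of 1.415

*-^-distrib : ∀ y z m → (y * z) ^ m ≡ y ^ m * z ^ m
*-^-distrib y z zero    = refl
*-^-distrib y z (suc m) = trans (cong (y * z *_) (*-^-distrib y z m))
  (solve 4 (λ y z u v → y :* z :* (u :* v) := (y :* u) :* (z :* v)) refl y z (y ^ m) (z ^ m))
  where open +-*-Solver

-- The factor n is absorbed by the ratio y² / 2x² = 1 + d / 2x² ≥ 1 + 1 / q: Bernoulli's inequality
-- gives m (2x²)ᵐ ≤ q (y²)ᵐ.
module _ (x y q d : ℕ) (x≤y : x ≤ y) (1≤q : 1 ≤ q) (y²≡ : y * y ≡ x * x * 2 + d) (2x²≤qd : x * x * 2 ≤ q * d) where

  private
    A B : ℕ
    A = x * x * 2
    B = y * y

  open ≤-Reasoning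
  open +-*-Solver

  bernoulli : ∀ m → (q + m) * A ^ m ≤ q * B ^ m
  bernoulli zero    = ≤-reflexive (cong (_* 1) (+-identityʳ q))
  bernoulli (suc m) = begin
    (q + suc m) * (A * A ^ m)         ≡⟨ solve 4 (λ q m a e → (q :+ (con 1 :+ m)) :* (a :* e) := ((q :+ m) :* a :+ a) :* e) refl q m A (A ^ m) ⟩
    -- From `A ≤ q * d` follows `A ≤ (q + m) * d`, so the extra `A` is paid for by passing from `A`
    -- to `B = A + d`.
    ((q + m) * A + A) * A ^ m         ≤⟨ *-monoˡ-≤ (A ^ m) (+-monoʳ-≤ ((q + m) * A) (≤-trans 2x²≤qd (*-monoˡ-≤ d (m≤m+n q m)))) ⟩
    ((q + m) * A + (q + m) * d) * A ^ m ≡⟨ cong (_* A ^ m) (trans (sym (*-distribˡ-+ (q + m) A d)) (cong ((q + m) *_) (sym y²≡))) ⟩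
    (q + m) * B * A ^ m               ≡⟨ solve 3 (λ s b e → s :* b :* e := b :* (s :* e)) refl (q + m) B (A ^ m) ⟩
    B * ((q + m) * A ^ m)             ≤⟨ *-monoʳ-≤ B (bernoulli m) ⟩
    B * (q * B ^ m)                   ≡⟨ solve 3 (λ q b e → b :* (q :* e) := q :* (b :* e)) refl q B (B ^ m) ⟩
    q * (B * B ^ m)                   ∎

  square-^ : ∀ z m → z ^ (m + m) ≡ (z * z) ^ m
  square-^ z m = trans (^-distribˡ-+-* z m m) (sym (*-^-distrib z z m))

  even-growth : ∀ m → x ^ (m + m) * (suc (m + m) * 2 ^ m) ≤ 2 * q * y ^ (m + m)
  even-growth m = begin
    x ^ (m + m) * (suc (m + m) * 2 ^ m)   ≡⟨ cong (_* (suc (m + m) * 2 ^ m)) (square-^ x m) ⟩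
    (x * x) ^ m * (suc (m + m) * 2 ^ m)   ≡⟨ solve 3 (λ e s t → e :* (s :* t) := s :* (e :* t)) refl ((x * x) ^ m) (suc (m + m)) (2 ^ m) ⟩
    suc (m + m) * ((x * x) ^ m * 2 ^ m)   ≡⟨ cong (suc (m + m) *_) (sym (*-^-distrib (x * x) 2 m)) ⟩
    suc (m + m) * A ^ m                   ≤⟨ *-monoˡ-≤ (A ^ m) 1+m+m≤ ⟩
    2 * (q + m) * A ^ m                   ≡⟨ *-assoc 2 (q + m) (A ^ m) ⟩
    2 * ((q + m) * A ^ m)                 ≤⟨ *-monoʳ-≤ 2 (bernoulli m) ⟩
    2 * (q * B ^ m)                       ≡⟨ *-assoc 2 q (B ^ m) ⟨
    2 * q * B ^ m                         ≡⟨ cong (2 * q *_) (square-^ y m) ⟨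
    2 * q * y ^ (m + m)                   ∎
    where
    1+m+m≤ : suc (m + m) ≤ 2 * (q + m)
    1+m+m≤ = ≤-trans (+-monoˡ-≤ (m + m) (≤-trans 1≤q (m≤m+n q q)))
      (≤-reflexive (solve 2 (λ q m → (q :+ q) :+ (m :+ m) := con 2 :* (q :+ m)) refl q m))

  even-or-odd : ∀ n → n ≡ ⌊ n /2⌋ + ⌊ n /2⌋ ⊎ n ≡ suc (⌊ n /2⌋ + ⌊ n /2⌋)
  even-or-odd zero          = inj₁ refl
  even-or-odd (suc zero)    = inj₂ refl
  even-or-odd (suc (suc n)) with even-or-odd n
  ... | inj₁ eq = inj₁ (cong suc (trans (cong suc eq) (sym (+-suc ⌊ n /2⌋ ⌊ n /2⌋))))
  ... | inj₂ eq = inj₂ (cong suc (cong suc (trans eq (sym (+-suc ⌊ n /2⌋ ⌊ n /2⌋)))))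

  -- For odd `n` both sides gain one more factor, `x` on the left and `y` on the right, and `x ≤ y`.
  growth : ∀ n → x ^ n * (n * 2 ^ ⌊ n /2⌋) ≤ 2 * q * y ^ n
  growth n = cases (even-or-odd n)
    where
    m : ℕ
    m = ⌊ n /2⌋
    goal : ℕ → Set
    goal l = x ^ l * (l * 2 ^ m) ≤ 2 * q * y ^ l
    cases : n ≡ m + m ⊎ n ≡ suc (m + m) → goal n
    cases (inj₁ eq) = subst goal (sym eq)
      (≤-trans (*-monoʳ-≤ (x ^ (m + m)) (*-monoˡ-≤ (2 ^ m) (n≤1+n (m + m)))) (even-growth m))
    cases (inj₂ eq) = subst goal (sym eq) (begin
      x * x ^ (m + m) * (suc (m + m) * 2 ^ m)   ≡⟨ *-assoc x (x ^ (m + m)) _ ⟩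
      x * (x ^ (m + m) * (suc (m + m) * 2 ^ m)) ≤⟨ *-mono-≤ x≤y (even-growth m) ⟩
      y * (2 * q * y ^ (m + m))                 ≡⟨ solve 3 (λ y q e → y :* (con 2 :* q :* e) := con 2 :* q :* (y :* e)) refl y q (y ^ (m + m)) ⟩
      2 * q * (y * y ^ (m + m))                 ∎)

theorem4p3 : (∃[ T ] ∃[ S ] PPMSolvableWithin T S
    × T ∈O (λ n → n * 2 ^ ⌊ n /2⌋)
    × S ∈O (λ n → n))
    × (λ n → 1000 ^ n * (n * 2 ^ ⌊ n /2⌋)) ∈O (λ n → 1415 ^ n)
theorem4p3 =
    ( _ , _ , (countSolutions , 20 , countSolutions-correct) , (189 , λ _ → ≤-refl) , (20 , λ _ → ≤-refl))
  -- Here `1415 * 1415 = 2000000 + 2225`, and 900 is a round number above `2000000 / 2225`.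
  , (2 * 900 , λ n → growth 1000 1415 900 2225 (≤ᵇ⇒≤ 1000 1415 _) (≤ᵇ⇒≤ 1 900 _) refl (≤ᵇ⇒≤ (1000 * 1000 * 2) (900 * 2225) _) n)
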